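{- Let $\mathsf{Paw}$ be the graph on $4$ vertices obtained from the triangle $K_3$ by appending a leaf to one of its vertices. The set of all ordered multiplicity lists attained by matrices in $\mathcal{S}_L(\mathsf{Paw})$ is exactly $\{(1,1,1,1), (1,1,2), (1,2,1)\}$.
   Context: For a finite simple graph $G$ on $n$ vertices, $\mathcal{S}_L(G)$ denotes the set of $n\times n$ real symmetric matrices $A=[a_{i,j}]$ such that $a_{i,j}<0$ if $\{i,j\}\in E(G)$, $a_{i,j}=0$ if $i\neq j$ and $\{i,j\}\notin E(G)$, and $a_{i,i}=-\sum_{k\neq i}a_{i,k}$ for all $i$. The ordered multiplicity list of $A\in\mathcal{S}_L(G)$ is $(m_1,\ldots,m_q)$, where $\lambda_1<\lambda_2<\cdots<\lambda_q$ are the distinct eigenvalues of $A$ in increasing order and $m_i$ is the multiplicity of $\lambda_i$. -}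

module Defs where

open import Level using (0ℓ)
open import Algebra.Bundles using (CommutativeRing)
import Algebra.Definitions.RawMonoid as RawMonoidDefinitions
open import Data.Empty using (⊥)
open import Data.Fin.Base using (Fin; zero; suc)
open import Data.List.Base using (List)
import Data.List.Membership.Setoid as SetoidMembership
open import Data.List.Relation.Binary.Pointwise using (Pointwise)
open import Data.List.Relation.Unary.Linked using (Linked)
open import Data.Nat.Base using (ℕ; suc)
open import Data.Product.Base using (∃; ∃-syntax; _×_)
open import Data.Vec.Functional using (Vector; updateAt)
open import Function.Bundles using (_⇔_)
open import Relation.Binary.Core using (Rel)
open import Relation.Binary.Definitions using (Symmetric; Irreflexive)
import Relation.Binary.Construct.StrictToNonStrict as StrictToNonStrict
open import Relation.Binary.PropositionalEquality.Core
  using (_≡_; _≢_; refl; ≢-sym)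
open import Relation.Binary.Structures using (IsStrictTotalOrder)
open import Relation.Nullary.Negation.Core using (¬_)

------------------------------------------------------------------------
-- Finite simple graphs

record SimpleGraph (n : ℕ) : Set₁ where
  field
    Adj           : Rel (Fin n) 0ℓ
    symmetric     : Symmetric Adj
    irreflexive   : Irreflexive _≡_ Adj

complete : ∀ n → SimpleGraph n
complete n = record
  { Adj         = _≢_
  ; symmetric   = ≢-sym
  ; irreflexive = λ i≡j i≢j → i≢j i≡j
  }

-- The new vertex is zero; a vertex i of G becomes suc i.
appendLeaf : ∀ {n} → SimpleGraph n → Fin n → SimpleGraph (suc n)
appendLeaf {n} G v = record
  { Adj         = Adj′
  ; symmetric   = λ {i} {j} → symmetric′ i j
  ; irreflexive = λ {i} {j} → irreflexive′ i j
  }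
  where
  open SimpleGraph G

  Adj′ : Rel (Fin (suc n)) 0ℓ
  Adj′ zero    zero    = ⊥
  Adj′ zero    (suc j) = j ≡ v
  Adj′ (suc i) zero    = i ≡ v
  Adj′ (suc i) (suc j) = Adj i j

  symmetric′ : ∀ i j → Adj′ i j → Adj′ j i
  symmetric′ zero    (suc j) p = p
  symmetric′ (suc i) zero    p = p
  symmetric′ (suc i) (suc j) p = symmetric p

  irreflexive′ : ∀ i j → i ≡ j → ¬ Adj′ i j
  irreflexive′ zero    .zero    refl ()
  irreflexive′ (suc i) .(suc i) refl p = irreflexive refl p

Paw : SimpleGraph 4
Paw = appendLeaf (complete 3) zero

------------------------------------------------------------------------
-- The real numbers

-- The library has no reals, so ℝ is given by its axioms: a Dedekind-complete
-- totally ordered field, which classically is unique up to isomorphism.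
-- The order is classical, i.e. trichotomous, so equality is decidable; hence
-- models are to be expected only in the presence of excluded middle.
record RealNumbers : Set₁ where
  infix 4 _<_
  field
    commutativeRing : CommutativeRing 0ℓ 0ℓ

  open CommutativeRing commutativeRing public

  field
    _<_                : Rel Carrier 0ℓ
    isStrictTotalOrder : IsStrictTotalOrder _≈_ _<_
    0≉1                : ¬ (0# ≈ 1#)
    inverse            : ∀ x → ¬ (x ≈ 0#) → ∃[ y ] x * y ≈ 1#
    +-monoˡ-<          : ∀ {x y} z → x < y → x + z < y + z
    *-pos              : ∀ {x y} → 0# < x → 0# < y → 0# < x * y

  open StrictToNonStrict _≈_ _<_ public using (_≤_)

  IsUpperBound : (Carrier → Set) → Carrier → Set
  IsUpperBound P u = ∀ x → P x → x ≤ u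

  field
    supremum : ∀ (P : Carrier → Set) → ∃ P → ∃ (IsUpperBound P) →
               ∃[ s ] (IsUpperBound P s × (∀ u → IsUpperBound P u → s ≤ u))

------------------------------------------------------------------------
-- Real matrices and their eigenvalues

module _ (ℝ : RealNumbers) where
  open RealNumbers ℝ hiding (refl)
  open RawMonoidDefinitions +-rawMonoid using (sum)
  open SetoidMembership setoid using (_∈_)

  Matrix : ℕ → Set
  Matrix n = Fin n → Fin n → Carrier

  mulVec : ∀ {n} → Matrix n → Vector Carrier n → Vector Carrier n
  mulVec A v i = sum (λ k → A i k * v k)

  linearCombination : ∀ {m n} → Vector Carrier m → Vector (Vector Carrier n) m →
                      Vector Carrier n
  linearCombination c b i = sum (λ k → c k * b k i)

  record IsBasis {n m} (P : Vector Carrier n → Set)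
                 (b : Vector (Vector Carrier n) m) : Set where
    field
      members     : ∀ k → P (b k)
      independent : ∀ c → (∀ i → linearCombination c b i ≈ 0#) → ∀ k → c k ≈ 0#
      spanning    : ∀ v → P v → ∃[ c ] (∀ i → v i ≈ linearCombination c b i)

  InEigenspace : ∀ {n} → Matrix n → Carrier → Vector Carrier n → Set
  InEigenspace A x v = ∀ i → mulVec A v i ≈ x * v i

  IsEigenvalue : ∀ {n} → Matrix n → Carrier → Set
  IsEigenvalue A x = ∃[ v ] (¬ (∀ i → v i ≈ 0#) × InEigenspace A x v)

  -- The dimension of the eigenspace; for real symmetric matrices this is also
  -- the multiplicity as a root of the characteristic polynomial.
  HasMultiplicity : ∀ {n} → Matrix n → Carrier → ℕ → Set
  HasMultiplicity {n} A x m =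
    ∃[ b ] IsBasis {n} {m} (InEigenspace A x) b

  -- ms is the ordered multiplicity list of A.
  record OrderedMultiplicityList {n} (A : Matrix n) (ms : List ℕ) : Set where
    field
      eigenvalues    : List Carrier
      increasing     : Linked _<_ eigenvalues
      complete-list  : ∀ x → IsEigenvalue A x ⇔ x ∈ eigenvalues
      multiplicities : Pointwise (HasMultiplicity A) eigenvalues ms

  -- The set 𝒮_L(G) of weighted Laplacians of G.
  record 𝒮L {n} (G : SimpleGraph n) (A : Matrix n) : Set where
    open SimpleGraph G using (Adj)
    field
      symmetric : ∀ i j → A i j ≈ A j i
      edge      : ∀ i j → Adj i j → A i j < 0#
      non-edge  : ∀ i j → i ≢ j → ¬ Adj i j → A i j ≈ 0#
      -- Overwriting the i-th entry of row i by 0 leaves the sum over k ≠ i.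
      diagonal  : ∀ i → A i i ≈ - sum (updateAt (A i) i (λ _ → 0#))

{-# OPTIONS --safe #-}
module Submission where

-- A weighted Laplacian of a connected graph is positive definite on 1^⊥.  Its top
-- eigenvalue is a supremum of Rayleigh quotients; deflating and repeating yields
-- an orthogonal eigenbasis 1, w₁, w₂, w₃ with 0 < λ₃ ≤ λ₂ ≤ λ₁, and any such basis
-- determines the ordered multiplicity list.  The list (1,3) is impossible because
-- the matrix would then act as a scalar on 1^⊥, in particular on e₀ − e₂, where 0
-- is the leaf and 2 a vertex of degree 2; but the 3-entry of the image is the
-- weight of the edge {2,3}.  The remaining lists are attained by integer weights
-- that are symmetric in 2 and 3: the spectrum then consists of 0, of b + 2d with
-- eigenvector e₂ − e₃, and of the roots of λ² − (2a + 3b)λ + 4ab, where a is the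
-- weight of the pendant edge, b of its two neighbours and d of the edge {2,3}.

open import Algebra.Bundles using (CommutativeRing)
open import Data.Empty using (⊥)
open import Data.Fin.Base using (Fin; zero; suc; punchIn; punchOut)
open import Data.Fin.Patterns using (0F; 1F; 2F; 3F)
open import Data.Fin.Properties as Fin using (any?; all?; punchIn-punchOut; suc-injective)
open import Data.Integer.Base as ℤ using (ℤ; +_; -[1+_])
import Data.Integer.Properties as ℤ
open import Data.List.Base using (List; []; _∷_)
open import Data.List.Membership.Propositional using (_∈_)
import Data.List.Membership.Setoid as SetoidMembership
import Data.List.Membership.Setoid.Properties as SetoidMembershipProperties
open import Data.List.Relation.Binary.Pointwise as Pointwise using (Pointwise; []; _∷_)
open import Data.List.Relation.Unary.All as All using (All; []; _∷_)
open import Data.List.Relation.Unary.AllPairs using (AllPairs; []; _∷_)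
open import Data.List.Relation.Unary.Any using (here; there)
open import Data.List.Relation.Unary.Linked using (Linked; [-]; _∷_)
open import Data.List.Relation.Unary.Linked.Properties using (Linked⇒AllPairs)
open import Data.Maybe.Base using (Maybe; just; nothing)
open import Data.Nat.Base as ℕ using (ℕ; zero; suc)
import Data.Nat.Properties as ℕ
open import Data.Product.Base using (∃; ∃-syntax; _×_; _,_; proj₁; proj₂)
open import Data.Sum.Base using (_⊎_; inj₁; inj₂; [_,_]′)
open import Data.Vec.Functional using (Vector; tail; foldr; updateAt)
  renaming ([] to ε; _∷_ to infixr 5 _◂_)
open import Data.Vec.Functional.Properties using (map-updateAt)
open import Function.Base using (_∘_)
open import Function.Bundles using (_⇔_; mk⇔; Equivalence)
open import Function.Definitions using (Injective)
import Relation.Binary.Bundles as Bundles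
open import Relation.Binary.Definitions using (tri<; tri≈; tri>)
import Relation.Binary.Properties.StrictTotalOrder as StrictTotalOrderProperties
open import Relation.Binary.PropositionalEquality.Core as ≡ using (_≡_; _≢_)
open import Relation.Binary.Structures using (IsStrictTotalOrder)
open import Relation.Nullary using (¬_; Dec; yes; no; contradiction; ¬?; decidable-stable)
open import Relation.Nullary.Decidable using (True; toWitness; _⊎-dec_)
open import Defs

-- The nonzero eigenvalues of a general matrix of the class are the roots of a cubic, so they have
-- to be produced from the axioms of the reals. The supremum axiom yields a least s with ⟨v, Av⟩ ≤
-- s⟨v, v⟩ but no vector at which equality holds, and compactness of the sphere is not at hand. The
-- vector comes from elimination instead: with decidable equality, sI - A has either a nonzero
-- kernel vector or a right inverse, and an inverse would allow s to be lowered. Deflation sends the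
-- eigenvalues already found to 0, so the next top eigenvector could be an old one. Positivity on
-- 1^⊥ excludes this: the new maximum is positive, hence different from 0. Square roots are avoided
-- throughout; eigenvectors are orthogonal but not normalised. An arbitrary list that satisfies the
-- definition is handled by comparison with the one read off the eigenbasis, since a matrix has at
-- most one list.

-- A ring solver with integer coefficients

module IntegerSolver {c ℓ} (R : CommutativeRing c ℓ) where
  open CommutativeRing R
  open import Algebra.Properties.Ring ring
  open import Algebra.Properties.Semiring.Mult.TCOptimised semiring
    using (×-homo-+; ×1-homo-*; 1+×) renaming (_×_ to _×ₙ_)
  open import Algebra.Solver.Ring.AlmostCommutativeRing
  open import Relation.Binary.Reasoning.Setoid setoid

  -- With the optimised multiples `fromℤ (+ 0)` and `fromℤ (+ 1)` reduce to `0#` and `1#`, so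
  -- `con (+ 0)` and `con (+ 1)` match these constants in goals that the solver closes by `refl`.
  fromℤ : ℤ → Carrier
  fromℤ (+ n)    = n ×ₙ 1#
  fromℤ -[1+ n ] = - (suc n ×ₙ 1#)

  fromℤ-neg : ∀ i → fromℤ (ℤ.- i) ≈ - fromℤ i
  fromℤ-neg (+ zero)  = sym -0#≈0#
  fromℤ-neg (+ suc n) = refl
  fromℤ-neg -[1+ n ]  = sym (-‿involutive _)

  fromℤ-⊖ : ∀ m n → fromℤ (m ℤ.⊖ n) ≈ m ×ₙ 1# - n ×ₙ 1#
  fromℤ-⊖ m zero = sym (trans (+-congˡ -0#≈0#) (+-identityʳ _))
  fromℤ-⊖ zero (suc n) = sym (+-identityˡ _)
  fromℤ-⊖ (suc m) (suc n) = begin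
    fromℤ (suc m ℤ.⊖ suc n)                 ≡⟨ ≡.cong fromℤ (ℤ.[1+m]⊖[1+n]≡m⊖n m n) ⟩
    fromℤ (m ℤ.⊖ n)                         ≈⟨ fromℤ-⊖ m n ⟩
    m′ - n′                                 ≈⟨ +-congʳ (+-identityˡ m′) ⟨
    0# + m′ - n′                            ≈⟨ +-congʳ (+-congʳ (-‿inverseˡ 1#)) ⟨
    - 1# + 1# + m′ - n′                     ≈⟨ +-congʳ (+-assoc _ _ _) ⟩
    - 1# + (1# + m′) - n′                   ≈⟨ +-congʳ (+-comm _ _) ⟩
    1# + m′ + - 1# - n′                     ≈⟨ +-assoc _ _ _ ⟩
    1# + m′ + (- 1# - n′)                   ≈⟨ +-congˡ (-‿+-comm 1# n′) ⟩
    1# + m′ - (1# + n′)                     ≈⟨ +-cong (1+× m 1#) (-‿cong (1+× n 1#)) ⟨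
    suc m ×ₙ 1# - suc n ×ₙ 1#               ∎
    where
    m′ = m ×ₙ 1#
    n′ = n ×ₙ 1#

  fromℤ-+ : ∀ i j → fromℤ (i ℤ.+ j) ≈ fromℤ i + fromℤ j
  fromℤ-+ (+ m)    (+ n)    = ×-homo-+ 1# m n
  fromℤ-+ (+ m)    -[1+ n ] = fromℤ-⊖ m (suc n)
  fromℤ-+ -[1+ m ] (+ n)    = trans (fromℤ-⊖ n (suc m)) (+-comm _ _)
  fromℤ-+ -[1+ m ] -[1+ n ] = begin
    - (suc (suc (m ℕ.+ n)) ×ₙ 1#)         ≡⟨ ≡.cong (λ k → - (suc k ×ₙ 1#)) (ℕ.+-suc m n) ⟨
    - ((suc m ℕ.+ suc n) ×ₙ 1#)           ≈⟨ -‿cong (×-homo-+ 1# (suc m) (suc n)) ⟩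
    - (suc m ×ₙ 1# + suc n ×ₙ 1#)         ≈⟨ -‿+-comm _ _ ⟨
    - (suc m ×ₙ 1#) - suc n ×ₙ 1#         ∎
    where import Data.Nat.Properties as ℕ

  fromℤ-+* : ∀ m j → fromℤ (+ m ℤ.* j) ≈ m ×ₙ 1# * fromℤ j
  fromℤ-+* m (+ n) = begin
    fromℤ (+ m ℤ.* + n)     ≡⟨ ≡.cong fromℤ (ℤ.pos-* m n) ⟨
    (m ℕ.* n) ×ₙ 1#         ≈⟨ ×1-homo-* m n ⟩
    m ×ₙ 1# * n ×ₙ 1#       ∎
  fromℤ-+* m -[1+ n ] = begin
    fromℤ (+ m ℤ.* (ℤ.- + suc n))  ≡⟨ ≡.cong fromℤ (ℤ.neg-distribʳ-* (+ m) (+ suc n)) ⟨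
    fromℤ (ℤ.- (+ m ℤ.* + suc n))  ≈⟨ fromℤ-neg (+ m ℤ.* + suc n) ⟩
    - fromℤ (+ m ℤ.* + suc n)      ≈⟨ -‿cong (fromℤ-+* m (+ suc n)) ⟩
    - (m ×ₙ 1# * suc n ×ₙ 1#)      ≈⟨ -‿distribʳ-* _ _ ⟩
    m ×ₙ 1# * - (suc n ×ₙ 1#)      ∎

  fromℤ-* : ∀ i j → fromℤ (i ℤ.* j) ≈ fromℤ i * fromℤ j
  fromℤ-* (+ m)    j = fromℤ-+* m j
  fromℤ-* -[1+ m ] j = begin
    fromℤ ((ℤ.- + suc m) ℤ.* j)    ≡⟨ ≡.cong fromℤ (ℤ.neg-distribˡ-* (+ suc m) j) ⟨
    fromℤ (ℤ.- (+ suc m ℤ.* j))    ≈⟨ fromℤ-neg (+ suc m ℤ.* j) ⟩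
    - fromℤ (+ suc m ℤ.* j)        ≈⟨ -‿cong (fromℤ-+* (suc m) j) ⟩
    - (suc m ×ₙ 1# * fromℤ j)      ≈⟨ -‿distribˡ-* _ _ ⟩
    - (suc m ×ₙ 1#) * fromℤ j      ∎

  homomorphism : ℤ.+-*-rawRing -Raw-AlmostCommutative⟶ fromCommutativeRing R
  homomorphism = record
    { ⟦_⟧    = fromℤ
    ; +-homo = fromℤ-+
    ; *-homo = fromℤ-*
    ; -‿homo = fromℤ-neg
    ; 0-homo = refl
    ; 1-homo = refl
    }

  fromℤ-≟ : ∀ i j → Maybe (fromℤ i ≈ fromℤ j)
  fromℤ-≟ i j with i ℤ.≟ j
  ... | yes ≡.refl = just refl
  ... | no _       = nothing

  open import Algebra.Solver.Ring ℤ.+-*-rawRing (fromCommutativeRing R) homomorphism fromℤ-≟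
    public using (solve; con; _:+_; _:*_; _:-_; :-_; _:=_)

-- Arithmetic of a totally ordered field

module OrderedField (ℝ : RealNumbers) where
  open RealNumbers ℝ
  open IntegerSolver commutativeRing
  open import Algebra.Properties.Ring ring
  open IsStrictTotalOrder isStrictTotalOrder public
    using (compare; _≟_; <-respʳ-≈; <-respˡ-≈) renaming (trans to <-trans; irrefl to <-irrefl)

  strictTotalOrder : Bundles.StrictTotalOrder _ _ _
  strictTotalOrder = record { isStrictTotalOrder = isStrictTotalOrder }

  open StrictTotalOrderProperties strictTotalOrder public
    using (≤-respʳ-≈; ≤-respˡ-≈) renaming (trans to ≤-trans)

  x<y⇒0<y-x : ∀ {x y} → x < y → 0# < y - x
  x<y⇒0<y-x {x} p = <-respˡ-≈ (-‿inverseʳ x) (+-monoˡ-< (- x) p)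

  0<y-x⇒x<y : ∀ {x y} → 0# < y - x → x < y
  0<y-x⇒x<y {x} {y} p =
    <-respˡ-≈ (+-identityˡ x)
      (<-respʳ-≈ (solve 2 (λ x y → y :- x :+ x := y) refl x y) (+-monoˡ-< x p))

  x≤y⇒0≤y-x : ∀ {x y} → x ≤ y → 0# ≤ y - x
  x≤y⇒0≤y-x (inj₁ p) = inj₁ (x<y⇒0<y-x p)
  x≤y⇒0≤y-x {x} (inj₂ p) = inj₂ (sym (trans (+-congʳ (sym p)) (-‿inverseʳ x)))

  0≤y-x⇒x≤y : ∀ {x y} → 0# ≤ y - x → x ≤ y
  0≤y-x⇒x≤y (inj₁ p) = inj₁ (0<y-x⇒x<y p)
  0≤y-x⇒x≤y {x} {y} (inj₂ p) = inj₂ (trans (sym (+-identityˡ x))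
    (trans (+-congʳ p) (solve 2 (λ x y → y :- x :+ x := y) refl x y)))

  x<0⇒0<-x : ∀ {x} → x < 0# → 0# < - x
  x<0⇒0<-x p = <-respʳ-≈ (+-identityˡ _) (x<y⇒0<y-x p)

  <⇒≱ : ∀ {x y} → x < y → ¬ (y ≤ x)
  <⇒≱ p (inj₁ q) = <-irrefl refl (<-trans p q)
  <⇒≱ p (inj₂ q) = <-irrefl (sym q) p

  ≰⇒> : ∀ {x y} → ¬ (x ≤ y) → y < x
  ≰⇒> {x} {y} p with compare x y
  ... | tri< q _ _ = contradiction (inj₁ q) p
  ... | tri≈ _ q _ = contradiction (inj₂ q) p
  ... | tri> _ _ q = q

  <-≤-trans : ∀ {x y z} → x < y → y ≤ z → x < z
  <-≤-trans p (inj₁ q) = <-trans p q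
  <-≤-trans p (inj₂ q) = <-respʳ-≈ q p

  ≤-refl : ∀ {x} → x ≤ x
  ≤-refl = inj₂ refl

  pos⇒≉0 : ∀ {x} → 0# < x → ¬ (x ≈ 0#)
  pos⇒≉0 p q = <-irrefl (sym q) p

  +-pos-nonneg : ∀ {x y} → 0# < x → 0# ≤ y → 0# < x + y
  +-pos-nonneg {x} {y} p (inj₁ q) =
    <-trans q (<-respˡ-≈ (+-identityˡ y) (+-monoˡ-< y p))
  +-pos-nonneg {x} p (inj₂ q) =
    <-respʳ-≈ (trans (sym (+-identityʳ x)) (+-congˡ q)) p

  +-nonneg : ∀ {x y} → 0# ≤ x → 0# ≤ y → 0# ≤ x + y
  +-nonneg (inj₁ p) q = inj₁ (+-pos-nonneg p q)
  +-nonneg (inj₂ p) q = ≤-respʳ-≈ (trans (sym (+-identityˡ _)) (+-congʳ p)) q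

  +-nonneg-pos : ∀ {x y} → 0# ≤ x → 0# < y → 0# < x + y
  +-nonneg-pos p q = <-respʳ-≈ (+-comm _ _) (+-pos-nonneg q p)

  *-nonneg : ∀ {x y} → 0# ≤ x → 0# ≤ y → 0# ≤ x * y
  *-nonneg (inj₁ p) (inj₁ q) = inj₁ (*-pos p q)
  *-nonneg {x} (inj₁ p) (inj₂ q) = inj₂ (trans (sym (zeroʳ x)) (*-congˡ q))
  *-nonneg {x} {y} (inj₂ p) _ = inj₂ (trans (sym (zeroˡ y)) (*-congʳ p))

  +-mono-≤ : ∀ {x y z w} → x ≤ y → z ≤ w → x + z ≤ y + w
  +-mono-≤ {x} {y} {z} {w} p q = 0≤y-x⇒x≤y (≤-respʳ-≈
    (solve 4 (λ x y z w → y :- x :+ (w :- z) := y :+ w :- (x :+ z)) refl x y z w)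
    (+-nonneg (x≤y⇒0≤y-x p) (x≤y⇒0≤y-x q)))

  square-pos : ∀ {x} → ¬ (x ≈ 0#) → 0# < x * x
  square-pos {x} x≉0 with compare x 0#
  ... | tri< p _ _ = <-respʳ-≈ (solve 1 (λ x → (:- x) :* (:- x) := x :* x) refl x)
                       (*-pos (x<0⇒0<-x p) (x<0⇒0<-x p))
  ... | tri≈ _ p _ = contradiction p x≉0
  ... | tri> _ _ p = *-pos p p

  square-nonneg : ∀ x → 0# ≤ x * x
  square-nonneg x with x ≟ 0#
  ... | yes p = inj₂ (sym (trans (*-congʳ p) (zeroˡ x)))
  ... | no  p = inj₁ (square-pos p)

  0<1 : 0# < 1#
  0<1 = <-respʳ-≈ (*-identityˡ 1#) (square-pos λ p → 0≉1 (sym p))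

  fromℤ-pos : ∀ n → 0# < fromℤ (+ suc n)
  fromℤ-pos zero    = 0<1
  fromℤ-pos (suc n) = +-pos-nonneg (fromℤ-pos n) (inj₁ 0<1)

  -- Between literals the hypothesis is `≡.refl` and `n` is found by unification, so such
  -- comparisons are settled by computation in ℤ.
  fromℤ-< : ∀ i j {n} → j ℤ.- i ≡ + suc n → fromℤ i < fromℤ j
  fromℤ-< i j {n} p = 0<y-x⇒x<y (<-respʳ-≈
    (trans (reflexive (≡.cong fromℤ (≡.sym p)))
      (trans (fromℤ-+ j (ℤ.- i)) (+-congˡ (fromℤ-neg i))))
    (fromℤ-pos n))

  x*y≈0⇒y≈0 : ∀ {x y} → ¬ (x ≈ 0#) → x * y ≈ 0# → y ≈ 0#
  x*y≈0⇒y≈0 {x} {y} x≉0 p =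
    let z , q = inverse x x≉0 in
    trans (sym (*-identityˡ y)) (trans (*-congʳ (sym q))
      (trans (solve 3 (λ x y z → x :* z :* y := z :* (x :* y)) refl x y z)
        (trans (*-congˡ p) (zeroʳ z))))

  x-y≈0⇒x≈y : ∀ {x y} → x - y ≈ 0# → x ≈ y
  x-y≈0⇒x≈y {x} {y} p =
    trans (solve 2 (λ x y → x := x :- y :+ y) refl x y) (trans (+-congʳ p) (+-identityˡ y))

  x≈y⇒x-y≈0 : ∀ {x y} → x ≈ y → x - y ≈ 0#
  x≈y⇒x-y≈0 {x} {y} p = trans (+-congʳ p) (-‿inverseʳ y)

  *-cancelˡ-0≤ : ∀ {x y} → 0# < x → 0# ≤ x * y → 0# ≤ y
  *-cancelˡ-0≤ {x} {y} p q with compare y 0#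
  ... | tri< r _ _ = contradiction q (<⇒≱ (0<y-x⇒x<y (<-respʳ-≈
                       (solve 2 (λ x y → x :* (:- y) := con (+ 0) :- x :* y) refl x y)
                       (*-pos p (x<0⇒0<-x r)))))
  ... | tri≈ _ r _ = inj₂ (sym r)
  ... | tri> _ _ r = inj₁ r

  *-cancelʳ-≤ : ∀ {x y z} → 0# < z → x * z ≤ y * z → x ≤ y
  *-cancelʳ-≤ {x} {y} {z} p q = 0≤y-x⇒x≤y (*-cancelˡ-0≤ p (≤-respʳ-≈
    (solve 3 (λ x y z → y :* z :- x :* z := z :* (y :- x)) refl x y z) (x≤y⇒0≤y-x q)))

  *-monoʳ-≤ : ∀ {x y z} → 0# ≤ z → x ≤ y → x * z ≤ y * z
  *-monoʳ-≤ {x} {y} {z} p q = 0≤y-x⇒x≤y (≤-respʳ-≈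
    (solve 3 (λ x y z → z :* (y :- x) := y :* z :- x :* z) refl x y z)
    (*-nonneg p (x≤y⇒0≤y-x q)))

  *-cancelˡ-0< : ∀ {x y} → 0# ≤ y → 0# < x * y → 0# < x
  *-cancelˡ-0< {x} {y} p q = ≰⇒> λ x≤0 → <⇒≱ q (0≤y-x⇒x≤y (≤-respʳ-≈
    (solve 2 (λ x y → (con (+ 0) :- x) :* y := con (+ 0) :- x :* y) refl x y)
    (*-nonneg (x≤y⇒0≤y-x x≤0) p)))

  inverse-pos : ∀ {x} → 0# < x → ∃[ y ] (0# < y × x * y ≈ 1#)
  inverse-pos {x} p =
    let y , q = inverse x (pos⇒≉0 p) in
    y , *-cancelˡ-0< (inj₁ p) (<-respʳ-≈ (trans (sym q) (*-comm x y)) 0<1) , q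

-- Inner products and homogeneous linear systems

module LinearAlgebra (ℝ : RealNumbers) where
  open RealNumbers ℝ hiding (zero)
  open IntegerSolver commutativeRing
  open OrderedField ℝ
  open import Algebra.Properties.Ring ring
  open import Algebra.Properties.Semiring.Sum semiring
  open import Relation.Binary.Reasoning.Setoid setoid

  sum-zero : ∀ {n} (f : Vector Carrier n) → (∀ i → f i ≈ 0#) → sum f ≈ 0#
  sum-zero {n} f p = trans (sum-cong-≋ p) (sum-replicate-zero n)

  sum-single : ∀ {n} (f : Vector Carrier n) k → (∀ i → i ≢ k → f i ≈ 0#) → sum f ≈ f k
  sum-single {suc n} f zero p =
    trans (+-congˡ (sum-zero (tail f) λ i → p (suc i) λ ())) (+-identityʳ _)
  sum-single {suc n} f (suc k) p =
    trans (+-cong (p zero λ ()) (sum-single (tail f) k λ i i≢k → p (suc i) (i≢k ∘ suc-injective)))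
      (+-identityˡ _)

  sum-neg : ∀ {n} (f : Vector Carrier n) → sum (λ i → - f i) ≈ - sum f
  sum-neg {zero}  f = sym -0#≈0#
  sum-neg {suc n} f = trans (+-congˡ (sum-neg (tail f))) (-‿+-comm _ _)

  sum-nonneg : ∀ {n} (f : Vector Carrier n) → (∀ i → 0# ≤ f i) → 0# ≤ sum f
  sum-nonneg {zero}  f p = ≤-refl
  sum-nonneg {suc n} f p = +-nonneg (p zero) (sum-nonneg (tail f) (p ∘ suc))

  sum-mono-≤ : ∀ {n} (f g : Vector Carrier n) → (∀ i → f i ≤ g i) → sum f ≤ sum g
  sum-mono-≤ {zero}  f g p = ≤-refl
  sum-mono-≤ {suc n} f g p = +-mono-≤ (p zero) (sum-mono-≤ (tail f) (tail g) (p ∘ suc))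

  term≤sum : ∀ {n} (f : Vector Carrier n) → (∀ i → 0# ≤ f i) → ∀ k → f k ≤ sum f
  term≤sum {suc n} f p zero =
    ≤-respˡ-≈ (+-identityʳ _) (+-mono-≤ ≤-refl (sum-nonneg (tail f) (p ∘ suc)))
  term≤sum {suc n} f p (suc k) =
    ≤-respˡ-≈ (+-identityˡ _) (+-mono-≤ (p zero) (term≤sum (tail f) (p ∘ suc) k))

  dot : ∀ {n} → Vector Carrier n → Vector Carrier n → Carrier
  dot x y = sum (λ i → x i * y i)

  Nonzero : ∀ {n} → Vector Carrier n → Set
  Nonzero v = ∃[ i ] ¬ (v i ≈ 0#)

  dot-comm : ∀ {n} (x y : Vector Carrier n) → dot x y ≈ dot y x
  dot-comm x y = sum-cong-≋ λ i → *-comm (x i) (y i)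

  dot-congˡ : ∀ {n} (x : Vector Carrier n) {y z} → (∀ i → y i ≈ z i) → dot x y ≈ dot x z
  dot-congˡ x p = sum-cong-≋ λ i → *-congˡ (p i)

  dot-congʳ : ∀ {n} (y : Vector Carrier n) {x z} → (∀ i → x i ≈ z i) → dot x y ≈ dot z y
  dot-congʳ y p = sum-cong-≋ λ i → *-congʳ (p i)

  dot-scaleˡ : ∀ {n} r (x y : Vector Carrier n) → dot (λ i → r * x i) y ≈ r * dot x y
  dot-scaleˡ r x y = trans (sum-cong-≋ λ i → *-assoc r (x i) (y i)) (sym (*-distribˡ-sum r (λ i → x i * y i)))

  dot-scaleʳ : ∀ {n} r (x y : Vector Carrier n) → dot x (λ i → r * y i) ≈ r * dot x y
  dot-scaleʳ r x y = trans (dot-comm x _) (trans (dot-scaleˡ r y x) (*-congˡ (dot-comm y x)))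

  dot-subˡ : ∀ {n} (x y z : Vector Carrier n) → dot (λ i → x i - y i) z ≈ dot x z - dot y z
  dot-subˡ x y z = begin
    sum (λ i → (x i - y i) * z i)           ≈⟨ sum-cong-≋ (λ i → [y-z]x≈yx-zx (z i) (x i) (y i)) ⟩
    sum (λ i → x i * z i - y i * z i)       ≈⟨ ∑-distrib-+ (λ i → x i * z i) _ ⟩
    dot x z + sum (λ i → - (y i * z i))     ≈⟨ +-congˡ (sum-neg (λ i → y i * z i)) ⟩
    dot x z - dot y z                       ∎

  dot-subʳ : ∀ {n} (x y z : Vector Carrier n) → dot x (λ i → y i - z i) ≈ dot x y - dot x z
  dot-subʳ x y z = trans (dot-comm x _)
    (trans (dot-subˡ y z x) (+-cong (dot-comm y x) (-‿cong (dot-comm z x))))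

  dot-combinationˡ : ∀ {m n} c (u : Vector (Vector Carrier n) m) y →
                     dot (linearCombination ℝ c u) y ≈ sum (λ k → c k * dot (u k) y)
  dot-combinationˡ {m} {n} c u y = begin
    sum (λ i → sum (λ k → c k * u k i) * y i)    ≈⟨ sum-cong-≋ (λ i → *-distribʳ-sum (y i) (λ k → c k * u k i)) ⟩
    sum (λ i → sum (λ k → c k * u k i * y i))    ≈⟨ ∑-comm (λ i k → c k * u k i * y i) ⟩
    sum (λ k → sum (λ i → c k * u k i * y i))    ≈⟨ sum-cong-≋ (λ k → dot-scaleˡ (c k) (u k) y) ⟩
    sum (λ k → c k * dot (u k) y)                ∎

  dot-combinationʳ : ∀ {m n} x c (u : Vector (Vector Carrier n) m) →
                     dot x (linearCombination ℝ c u) ≈ sum (λ k → c k * dot x (u k))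
  dot-combinationʳ x c u = trans (dot-comm x _)
    (trans (dot-combinationˡ c u x) (sum-cong-≋ λ k → *-congˡ (dot-comm (u k) x)))

  -- By symmetry `mulVec ℝ A x` is the combination of the rows of `A` with coefficients `x`; pairing
  -- it with `y` row by row gives `dot x (mulVec ℝ A y)` by definition.
  self-adjoint : ∀ {n} (A : Matrix ℝ n) → (∀ i j → A i j ≈ A j i) →
                 ∀ x y → dot (mulVec ℝ A x) y ≈ dot x (mulVec ℝ A y)
  self-adjoint A A-sym x y = trans
    (dot-congʳ y λ i → sum-cong-≋ λ k → trans (*-comm _ _) (*-congˡ (A-sym i k)))
    (dot-combinationˡ x A y)

  dot-nonneg : ∀ {n} (v : Vector Carrier n) → 0# ≤ dot v v
  dot-nonneg v = sum-nonneg _ λ i → square-nonneg (v i)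

  square≤dot : ∀ {n} (v : Vector Carrier n) i → v i * v i ≤ dot v v
  square≤dot v = term≤sum _ λ i → square-nonneg (v i)

  dot-pos : ∀ {n} (v : Vector Carrier n) → Nonzero v → 0# < dot v v
  dot-pos v (i , vᵢ≉0) = <-≤-trans (square-pos vᵢ≉0) (square≤dot v i)

  nonzero? : ∀ {n} (v : Vector Carrier n) → Nonzero v ⊎ (∀ i → v i ≈ 0#)
  nonzero? v with any? (λ i → ¬? (v i ≟ 0#))
  ... | yes p = inj₁ p
  ... | no ¬p = inj₂ λ i → decidable-stable (v i ≟ 0#) λ vᵢ≉0 → ¬p (i , vᵢ≉0)

  -- Gaussian elimination, by induction on the number of equations. If the first column vanishes,
  -- the first unit vector is a solution; otherwise a row `p` with nonzero leading entry `q`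
  -- eliminates the first unknown. Rows are cross-multiplied, so no division occurs. All later
  -- dimension arguments rest on this lemma.
  nontrivial-solution : ∀ {m n} → m ℕ.< n → (M : Vector (Vector Carrier n) m) →
                        ∃[ c ] (Nonzero c × ∀ i → dot (M i) c ≈ 0#)
  nontrivial-solution {zero} {suc n} _ M = (λ _ → 1#) , (zero , λ p → 0≉1 (sym p)) , λ ()
  nontrivial-solution {suc m} {suc n} (ℕ.s≤s m<n) M with any? (λ p → ¬? (M p zero ≟ 0#))
  ... | no ¬p = 1# ◂ (λ _ → 0#) , (zero , λ p → 0≉1 (sym p)) , λ i →
    trans (+-cong
      (trans (*-identityʳ _) (decidable-stable (M i zero ≟ 0#) λ q → ¬p (i , q)))
      (sum-zero _ λ j → zeroʳ (M i (suc j))))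
    (+-identityˡ 0#)
  ... | yes (p , q≉0) = c , (suc (proj₁ nz) , λ r → proj₂ nz (x*y≈0⇒y≈0 q≉0 r)) , solves
    where
    q = M p zero

    M′ : Vector (Vector Carrier n) m
    M′ i j = q * M (punchIn p i) (suc j) - M (punchIn p i) zero * M p (suc j)

    ih = nontrivial-solution m<n M′
    c′ = proj₁ ih
    nz = proj₁ (proj₂ ih)

    pivot = dot (tail (M p)) c′

    c : Vector Carrier (suc n)
    -- The head is chosen to make row `p` vanish. Back substitution would divide it by `q`;
    -- multiplying the tail by `q` has the same effect, and `q≉0` keeps `c` nonzero.
    c = (- pivot) ◂ (λ j → q * c′ j)

    row : ∀ i → dot (M i) c ≈ q * dot (tail (M i)) c′ - M i zero * pivot
    row i = trans (+-congˡ (dot-scaleʳ q (tail (M i)) c′))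
      (solve 3 (λ a b c → a :* (:- b) :+ c := c :- a :* b) refl _ _ _)

    solves-punchIn : ∀ i → dot (M (punchIn p i)) c ≈ 0#
    solves-punchIn i = begin
      dot (M (punchIn p i)) c                        ≈⟨ row (punchIn p i) ⟩
      q * dot r c′ - M (punchIn p i) zero * pivot    ≈⟨ +-cong (dot-scaleˡ q r c′) (-‿cong (dot-scaleˡ (M (punchIn p i) zero) (tail (M p)) c′)) ⟨
      dot (λ j → q * r j) c′ - dot (λ j → M (punchIn p i) zero * M p (suc j)) c′
                                                     ≈⟨ dot-subˡ (λ j → q * r j) _ c′ ⟨
      dot (M′ i) c′                                  ≈⟨ proj₂ (proj₂ ih) i ⟩
      0#                                             ∎
      where r = tail (M (punchIn p i))

    solves : ∀ i → dot (M i) c ≈ 0#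
    solves i with p Fin.≟ i
    ... | yes ≡.refl = trans (row p) (-‿inverseʳ _)
    ... | no p≢i     = ≡.subst (λ i → dot (M i) c ≈ 0#) (punchIn-punchOut p≢i) (solves-punchIn (punchOut p≢i))

-- The largest eigenvalue of a symmetric matrix

module Spectral (ℝ : RealNumbers) where
  open RealNumbers ℝ hiding (zero)
  open IntegerSolver commutativeRing
  open OrderedField ℝ
  open LinearAlgebra ℝ
  open import Algebra.Properties.Ring ring
  open import Algebra.Properties.Semiring.Sum semiring
  open import Relation.Binary.Reasoning.Setoid setoid

  product-bound : ∀ a {x y N} → x * x ≤ N → y * y ≤ N → x * (a * y) ≤ (1# + a * a) * N
  product-bound a {x} {y} {N} p q = 0≤y-x⇒x≤y (≤-respʳ-≈
    (solve 4 (λ a x y N → N :- x :* x :+ a :* a :* (N :- y :* y)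
                            :+ (x :* x :+ a :* a :* (y :* y) :- x :* (a :* y))
                          := (con (+ 1) :+ a :* a) :* N :- x :* (a :* y)) refl a x y N)
    (+-nonneg
      (+-nonneg (x≤y⇒0≤y-x p) (*-nonneg (square-nonneg a) (x≤y⇒0≤y-x q)))
      -- Completing the square: 4(x² + a²y² - xay) = (2x - ay)² + 3(ay)². The argument of
      -- `fromℤ-pos` is one less than the number, so 3 and 2 stand for 4 and 3.
      (*-cancelˡ-0≤ (fromℤ-pos 3) (≤-respʳ-≈
        (solve 3 (λ a x y → (con (+ 2) :* x :- a :* y) :* (con (+ 2) :* x :- a :* y)
                              :+ con (+ 3) :* ((a :* y) :* (a :* y))
                            := con (+ 4) :* (x :* x :+ a :* a :* (y :* y) :- x :* (a :* y)))
          refl a x y)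
        (+-nonneg (square-nonneg _) (*-nonneg (inj₁ (fromℤ-pos 2)) (square-nonneg _)))))))

  -- `product-bound` summed over all entries. The estimate is crude but asks for no symmetry, so it
  -- also applies to the inverse in `not-invertible`; the summand `1#` makes `K` positive, hence
  -- invertible.
  quadratic-bound : ∀ {n} (M : Matrix ℝ n) →
                    ∃[ K ] (0# < K × ∀ v → dot v (mulVec ℝ M v) ≤ K * dot v v)
  quadratic-bound {n} M = 1# + sum k , K>0 , λ v → ≤-trans (sum-bound v)
      (*-monoʳ-≤ (dot-nonneg v) (≤-respˡ-≈ (+-identityˡ _) (+-mono-≤ (inj₁ 0<1) ≤-refl)))
    where
    k : Vector Carrier n
    k i = sum λ j → 1# + M i j * M i j

    K>0 : 0# < 1# + sum k
    K>0 = +-pos-nonneg 0<1 (sum-nonneg k λ i → sum-nonneg _ λ j →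
            +-nonneg (inj₁ 0<1) (square-nonneg (M i j)))

    row-bound : ∀ v i → v i * mulVec ℝ M v i ≤ k i * dot v v
    row-bound v i = ≤-respˡ-≈ (sym (*-distribˡ-sum (v i) λ j → M i j * v j))
      (≤-respʳ-≈ (sym (*-distribʳ-sum (dot v v) λ j → 1# + M i j * M i j))
        (sum-mono-≤ _ _ λ j → product-bound (M i j) (square≤dot v i) (square≤dot v j)))

    sum-bound : ∀ v → dot v (mulVec ℝ M v) ≤ sum k * dot v v
    sum-bound v = ≤-respʳ-≈ (sym (*-distribʳ-sum (dot v v) k)) (sum-mono-≤ _ _ (row-bound v))

  δ : ∀ {n} → Matrix ℝ n
  δ i j with i Fin.≟ j
  ... | yes _ = 1#
  ... | no  _ = 0#

  δ-diagonal : ∀ {n} (i : Fin n) → δ i i ≈ 1#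
  δ-diagonal i with i Fin.≟ i
  ... | yes _  = refl
  ... | no i≢i = contradiction ≡.refl i≢i

  δ-off-diagonal : ∀ {n} {i j : Fin n} → i ≢ j → δ i j ≈ 0#
  δ-off-diagonal {i = i} {j} i≢j with i Fin.≟ j
  ... | yes i≡j = contradiction i≡j i≢j
  ... | no _    = refl

  dot-δ : ∀ {n} i (v : Vector Carrier n) → dot (δ i) v ≈ v i
  dot-δ i v = trans
    (sum-single _ i λ j j≢i → trans (*-congʳ (δ-off-diagonal (j≢i ∘ ≡.sym))) (zeroˡ _))
    (trans (*-congʳ (δ-diagonal i)) (*-identityˡ _))

  Singular : ∀ {n} → Matrix ℝ n → Set
  Singular M = ∃[ w ] (Nonzero w × ∀ i → mulVec ℝ M w i ≈ 0#)

  -- The `n` by `n + 1` matrix with `y` as extra first column has a nonzero kernel vector `c`. If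
  -- its first coordinate is zero, the rest is a kernel vector of `M`; otherwise dividing the rest
  -- by minus that coordinate solves M x = y.
  solution-or-singular : ∀ {n} (M : Matrix ℝ n) (y : Vector Carrier n) →
                         Singular M ⊎ ∃[ x ] (∀ i → mulVec ℝ M x i ≈ y i)
  solution-or-singular {n} M y with nontrivial-solution (ℕ.n<1+n n) (λ i → y i ◂ M i)
  ... | c , nz , eqs with c zero ≟ 0#
  ...   | yes c₀≈0 = inj₁ (tail c , tail-nonzero nz , λ i → trans
            (trans (sym (+-identityˡ _)) (+-congʳ (sym (trans (*-congˡ c₀≈0) (zeroʳ (y i))))))
            (eqs i))
    where
    tail-nonzero : Nonzero c → Nonzero (tail c)
    tail-nonzero (zero  , c₀≉0) = contradiction c₀≈0 c₀≉0
    tail-nonzero (suc j , cⱼ≉0) = j , cⱼ≉0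
  ...   | no c₀≉0 = let d , c₀d≈1 = inverse (c zero) c₀≉0 in
    inj₂ ((λ j → - d * tail c j) , λ i → begin
      dot (M i) (λ j → - d * tail c j)             ≈⟨ dot-scaleʳ (- d) (M i) (tail c) ⟩
      - d * dot (M i) (tail c)                     ≈⟨ solve 4 (λ d m c y → (:- d) :* m := c :* d :* y :- d :* (y :* c :+ m)) refl d (dot (M i) (tail c)) (c zero) (y i) ⟩
      c zero * d * y i - d * (y i * c zero + dot (M i) (tail c))
                                                   ≈⟨ +-cong (*-congʳ c₀d≈1) (-‿cong (*-congˡ (eqs i))) ⟩
      1# * y i - d * 0#                            ≈⟨ solve 2 (λ d y → con (+ 1) :* y :- d :* con (+ 0) := y) refl d (y i) ⟩
      y i                                          ∎)

  all-or-one : ∀ {n} {P : Set} {Q : Fin n → Set} → (∀ i → P ⊎ Q i) → P ⊎ (∀ i → Q i)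
  all-or-one {zero} f = inj₂ λ ()
  all-or-one {suc n} f with f zero | all-or-one (f ∘ suc)
  ... | inj₁ p | _      = inj₁ p
  ... | inj₂ _ | inj₁ p = inj₁ p
  ... | inj₂ q | inj₂ g = inj₂ λ { zero → q ; (suc i) → g i }

  -- Column `j` of `C` is a solution of M x = eⱼ. By linearity `C` is a right inverse, which is the
  -- form in which `not-invertible` refutes it.
  inverse-or-singular : ∀ {n} (M : Matrix ℝ n) →
    Singular M ⊎ ∃[ C ] (∀ v i → mulVec ℝ M (mulVec ℝ C v) i ≈ v i)
  inverse-or-singular M with all-or-one (λ j → solution-or-singular M (λ i → δ i j))
  ... | inj₁ p = inj₁ p
  ... | inj₂ f = inj₂ ((λ i j → proj₁ (f j) i) , λ v i → begin
    dot (M i) (λ k → sum λ j → proj₁ (f j) k * v j)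
      ≈⟨ dot-congˡ (M i) (λ k → sum-cong-≋ λ j → *-comm (proj₁ (f j) k) (v j)) ⟩
    dot (M i) (linearCombination ℝ v λ j → proj₁ (f j))
      ≈⟨ dot-combinationʳ (M i) v (λ j → proj₁ (f j)) ⟩
    sum (λ j → v j * dot (M i) (proj₁ (f j)))
      ≈⟨ sum-cong-≋ (λ j → trans (*-congˡ (proj₂ (f j) i)) (*-comm (v j) (δ i j))) ⟩
    dot (δ i) v
      ≈⟨ dot-δ i v ⟩
    v i ∎)

  quadratic-form-zero : ∀ {n} {v : Vector Carrier n} → (∀ i → v i ≈ 0#) → ∀ y → dot v y ≈ 0#
  quadratic-form-zero p y = sum-zero _ λ i → trans (*-congʳ (p i)) (zeroˡ (y i))

  -- The top eigenvalue is the supremum s of the Rayleigh quotients.  If sI − A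
  -- had an inverse C with ⟨v, Cv⟩ ≤ K⟨v, v⟩, then nonnegativity of the form
  -- sI − A at v − Cv/K would give ⟨v, Av⟩ ≤ (s − 1/K)⟨v, v⟩ for all v.
  module _ {n} (A : Matrix ℝ (suc n)) (A-sym : ∀ i j → A i j ≈ A j i) where
    private
      Q : Vector Carrier (suc n) → Carrier
      Q v = dot v (mulVec ℝ A v)

      -- The downward closure of the set of Rayleigh quotients, which has the same upper bounds; the
      -- inequality is cross-multiplied to keep division out.
      RayleighBelow : Carrier → Set
      RayleighBelow r = ∃[ v ] (Nonzero v × r * dot v v ≤ Q v)

      rayleigh : ∀ v → Nonzero v → ∃[ r ] r * dot v v ≈ Q v
      rayleigh v nz =
        let t , N*t≈1 = inverse (dot v v) (pos⇒≉0 (dot-pos v nz)) in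
        Q v * t , trans (solve 3 (λ q t N → q :* t :* N := q :* (N :* t)) refl (Q v) t (dot v v))
                    (trans (*-congˡ N*t≈1) (*-identityʳ _))

      rayleigh-nonempty : ∃ RayleighBelow
      rayleigh-nonempty =
        let v  = λ _ → 1#
            nz = zero , λ p → 0≉1 (sym p)
            r , p = rayleigh v nz
        in r , v , nz , inj₂ p

      rayleigh-bounded : ∃ (IsUpperBound RayleighBelow)
      rayleigh-bounded =
        let K , _ , bound = quadratic-bound A in
        K , λ { r (v , nz , p) → *-cancelʳ-≤ (dot-pos v nz) (≤-trans p (bound v)) }

      bound-from-quotients : ∀ {s} → IsUpperBound RayleighBelow s → ∀ v → Q v ≤ s * dot v v
      bound-from-quotients {s} ub v = [ nonzero-case , zero-case ]′ (nonzero? v)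
        where
        nonzero-case : Nonzero v → Q v ≤ s * dot v v
        nonzero-case nz = let r , p = rayleigh v nz in
          ≤-respˡ-≈ p (*-monoʳ-≤ (dot-nonneg v) (ub r (v , nz , inj₂ p)))

        zero-case : (∀ i → v i ≈ 0#) → Q v ≤ s * dot v v
        zero-case v≈0 = inj₂ (trans (quadratic-form-zero v≈0 (mulVec ℝ A v))
          (sym (trans (*-congˡ (quadratic-form-zero v≈0 v)) (zeroʳ s))))

    least-quadratic-bound : ∃[ s ] ((∀ v → Q v ≤ s * dot v v)
                                    × ∀ t → (∀ v → Q v ≤ t * dot v v) → s ≤ t)
    least-quadratic-bound =
      let s , ub , least = supremum RayleighBelow rayleigh-nonempty rayleigh-bounded in
      s , bound-from-quotients ub , λ t bound → least t
        λ { r (v , nz , p) → *-cancelʳ-≤ (dot-pos v nz) (≤-trans p (bound v)) }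

    module _ (s : Carrier) (Q≤s : ∀ v → Q v ≤ s * dot v v)
             (least : ∀ t → (∀ v → Q v ≤ t * dot v v) → s ≤ t) where
      -- The action of sI - A, written without the identity matrix for computations; `M` is the
      -- matrix of the same map, as elimination requires one.
      T : Vector Carrier (suc n) → Vector Carrier (suc n)
      T v i = s * v i - mulVec ℝ A v i

      M : Matrix ℝ (suc n)
      M i j = s * δ i j - A i j

      M≈T : ∀ v i → mulVec ℝ M v i ≈ T v i
      M≈T v i = trans (dot-subˡ (λ j → s * δ i j) (A i) v)
        (+-congʳ (trans (dot-scaleˡ s (δ i) v) (*-congˡ (dot-δ i v))))

      dot-T : ∀ x v → dot x (T v) ≈ s * dot x v - dot x (mulVec ℝ A v)
      dot-T x v = trans (dot-subʳ x (λ i → s * v i) (mulVec ℝ A v)) (+-congʳ (dot-scaleʳ s x v))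

      T-self-adjoint : ∀ x v → dot x (T v) ≈ dot (T x) v
      T-self-adjoint x v = begin
        dot x (T v)                                ≈⟨ dot-T x v ⟩
        s * dot x v - dot x (mulVec ℝ A v)         ≈⟨ +-cong (dot-scaleˡ s x v) (-‿cong (self-adjoint A A-sym x v)) ⟨
        dot (λ i → s * x i) v - dot (mulVec ℝ A x) v  ≈⟨ dot-subˡ (λ i → s * x i) (mulVec ℝ A x) v ⟨
        dot (T x) v                                ∎

      T-linear : ∀ v t x i → T (λ i → v i - t * x i) i ≈ T v i - t * T x i
      T-linear v t x i = trans
        (+-congˡ (-‿cong (trans (dot-subʳ (A i) v (λ i → t * x i)) (+-congˡ (-‿cong (dot-scaleʳ t (A i) x))))))
        (solve 6 (λ s v t x a b → s :* (v :- t :* x) :- (a :- t :* b)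
                   := s :* v :- a :- t :* (s :* x :- b)) refl s (v i) t (x i) (mulVec ℝ A v i) (mulVec ℝ A x i))

      T-nonneg : ∀ v → 0# ≤ dot v (T v)
      T-nonneg v = ≤-respʳ-≈ (sym (dot-T v v)) (x≤y⇒0≤y-x (Q≤s v))

      not-invertible : ¬ (∃[ C ] (∀ v i → mulVec ℝ M (mulVec ℝ C v) i ≈ v i))
      not-invertible (C , MC≈1) = <⇒≱ s-t<s (least (s - t) Q≤s-t)
        where
        K = proj₁ (quadratic-bound C)
        C-bound = proj₂ (proj₂ (quadratic-bound C))
        K-inverse = inverse-pos (proj₁ (proj₂ (quadratic-bound C)))
        t = proj₁ K-inverse

        s-t<s : s - t < s
        s-t<s = 0<y-x⇒x<y (<-respʳ-≈ (solve 2 (λ s t → t := s :- (s :- t)) refl s t)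
                  (proj₁ (proj₂ K-inverse)))

        Q≤s-t : ∀ v → Q v ≤ (s - t) * dot v v
        Q≤s-t v = 0≤y-x⇒x≤y (≤-respʳ-≈ combine
            (+-nonneg (T-nonneg z)
              (*-nonneg (square-nonneg t) (x≤y⇒0≤y-x (C-bound v)))))
          where
          x = mulVec ℝ C v
          N = dot v v
          z : Vector Carrier (suc n)
          z i = v i - t * x i

          Tx≈v : ∀ i → T x i ≈ v i
          Tx≈v i = trans (sym (M≈T x i)) (MC≈1 v i)

          expand : dot z (T z) ≈ dot v (T v) - t * N - t * (N - t * dot v x)
          expand = begin
            dot z (T z)                                   ≈⟨ dot-congˡ z (λ i → trans (T-linear v t x i) (+-congˡ (-‿cong (*-congˡ (Tx≈v i))))) ⟩
            dot z (λ i → T v i - t * v i)                 ≈⟨ dot-subˡ v (λ i → t * x i) (λ i → T v i - t * v i) ⟩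
            dot v Tv-tv - dot (λ i → t * x i) Tv-tv       ≈⟨ +-cong (split v) (-‿cong (trans (dot-scaleˡ t x Tv-tv) (*-congˡ (split x)))) ⟩
            dot v (T v) - t * N - t * (dot x (T v) - t * dot x v)
              ≈⟨ +-congˡ (-‿cong (*-congˡ (+-cong (trans (T-self-adjoint x v) (dot-congʳ v Tx≈v)) (-‿cong (*-congˡ (dot-comm x v)))))) ⟩
            dot v (T v) - t * N - t * (N - t * dot v x)   ∎
            where
            Tv-tv : Vector Carrier (suc n)
            Tv-tv i = T v i - t * v i

            split : ∀ y → dot y Tv-tv ≈ dot y (T v) - t * dot y v
            split y = trans (dot-subʳ y (T v) (λ i → t * v i)) (+-congˡ (-‿cong (dot-scaleʳ t y v)))

          -- From Tx = v and self-adjointness, ⟨z, Tz⟩ = ⟨v, Tv⟩ - 2tN + t²⟨v, x⟩. Replacing ⟨v, x⟩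
          -- by its bound KN turns the last term into tN, as Kt = 1, which leaves ⟨v, Tv⟩ - tN.
          combine : dot z (T z) + t * t * (K * N - dot v x) ≈ (s - t) * N - Q v
          combine = begin
            dot z (T z) + t * t * (K * N - dot v x)
              ≈⟨ +-congʳ (trans expand (+-congʳ (+-congʳ (dot-T v v)))) ⟩
            s * N - Q v - t * N - t * (N - t * dot v x) + t * t * (K * N - dot v x)
              ≈⟨ solve 6 (λ s N q t d K →
                   s :* N :- q :- t :* N :- t :* (N :- t :* d) :+ t :* t :* (K :* N :- d)
                   := (s :- t) :* N :- q :+ t :* N :* (K :* t :- con (+ 1)))
                   refl s N (Q v) t (dot v x) K ⟩
            (s - t) * N - Q v + t * N * (K * t - 1#)
              ≈⟨ +-congˡ (trans (*-congˡ (x≈y⇒x-y≈0 (proj₂ (proj₂ K-inverse)))) (zeroʳ _)) ⟩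
            (s - t) * N - Q v + 0#
              ≈⟨ +-identityʳ _ ⟩
            (s - t) * N - Q v ∎

      kernel-eigenpair : ∃[ w ] (Nonzero w × InEigenspace ℝ A s w)
      kernel-eigenpair with inverse-or-singular M
      ... | inj₂ C = contradiction C not-invertible
      ... | inj₁ (w , nz , Mw≈0) =
        w , nz , λ i → sym (x-y≈0⇒x≈y (trans (sym (M≈T w i)) (Mw≈0 i)))

    principal-eigenpair : ∃[ s ] ((∀ v → dot v (mulVec ℝ A v) ≤ s * dot v v)
                                  × ∃[ w ] (Nonzero w × InEigenspace ℝ A s w))
    principal-eigenpair =
      let s , Q≤s , least = least-quadratic-bound in
      s , Q≤s , kernel-eigenpair s Q≤s least

-- Orthogonal families of eigenvectors and deflation

module Multiplicity (ℝ : RealNumbers) where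
  open RealNumbers ℝ hiding (zero)
  open IntegerSolver commutativeRing
  open OrderedField ℝ
  open LinearAlgebra ℝ
  open Spectral ℝ
  open import Algebra.Properties.Ring ring
  open import Algebra.Properties.Semiring.Sum semiring
  open import Relation.Binary.Reasoning.Setoid setoid
  open SetoidMembership setoid using () renaming (_∈_ to _∈ₛ_)

  record OrthogonalFamily {k n} (u : Vector (Vector Carrier n) k) : Set where
    field
      nonzero    : ∀ i → Nonzero (u i)
      orthogonal : ∀ i j → i ≢ j → dot (u i) (u j) ≈ 0#

    norm-pos : ∀ i → 0# < dot (u i) (u i)
    norm-pos i = dot-pos (u i) (nonzero i)

    dot-combination : ∀ c j → dot (linearCombination ℝ c u) (u j) ≈ c j * dot (u j) (u j)
    dot-combination c j = trans (dot-combinationˡ c u (u j))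
      (sum-single (λ i → c i * dot (u i) (u j)) j λ i i≢j → trans (*-congˡ (orthogonal i j i≢j)) (zeroʳ (c i)))

    independent : ∀ c → (∀ i → linearCombination ℝ c u i ≈ 0#) → ∀ j → c j ≈ 0#
    independent c p j = x*y≈0⇒y≈0 (pos⇒≉0 (norm-pos j))
      (trans (*-comm _ (c j)) (trans (sym (dot-combination c j)) (quadratic-form-zero p (u j))))

  -- The `n + 1` vectors `v`, `u` satisfy a nontrivial relation. Pairing it with each `u k` kills
  -- the coefficients of `u`, so the coefficient of `v` is nonzero and `v` vanishes. This takes the
  -- place of the statement that `u` spans.
  maximal-orthogonal : ∀ {n} {u : Vector (Vector Carrier n) n} → OrthogonalFamily u →
                       ∀ v → (∀ k → dot v (u k) ≈ 0#) → ∀ i → v i ≈ 0#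
  maximal-orthogonal {n} {u} orth v v⊥u = v≈0
    where
    open OrthogonalFamily orth
    v∷u : Vector (Vector Carrier n) (suc n)
    v∷u = v ◂ u

    relation = nontrivial-solution (ℕ.n<1+n n) (λ i k → v∷u k i)
    c = proj₁ relation

    combination≈0 : ∀ i → linearCombination ℝ c v∷u i ≈ 0#
    combination≈0 i = trans (dot-comm c (λ k → v∷u k i)) (proj₂ (proj₂ relation) i)

    c-tail≈0 : ∀ k → c (suc k) ≈ 0#
    c-tail≈0 k = x*y≈0⇒y≈0 (pos⇒≉0 (norm-pos k)) (begin
      dot (u k) (u k) * c (suc k)                        ≈⟨ *-comm _ _ ⟩
      c (suc k) * dot (u k) (u k)                        ≈⟨ dot-combination (tail c) k ⟨
      dot (linearCombination ℝ (tail c) u) (u k)         ≈⟨ dot-combinationˡ (tail c) u (u k) ⟩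
      sum (λ j → c (suc j) * dot (u j) (u k))            ≈⟨ +-identityˡ _ ⟨
      0# + sum (λ j → c (suc j) * dot (u j) (u k))       ≈⟨ +-congʳ (trans (*-congˡ (v⊥u k)) (zeroʳ (c zero))) ⟨
      sum (λ j → c j * dot (v∷u j) (u k))                ≈⟨ dot-combinationˡ c v∷u (u k) ⟨
      dot (linearCombination ℝ c v∷u) (u k)              ≈⟨ quadratic-form-zero combination≈0 (u k) ⟩
      0#                                                 ∎)

    c₀≉0 : Nonzero c → ¬ (c zero ≈ 0#)
    c₀≉0 (zero  , p) = p
    c₀≉0 (suc k , p) = contradiction (c-tail≈0 k) p

    v≈0 : ∀ i → v i ≈ 0#
    v≈0 i = x*y≈0⇒y≈0 (c₀≉0 (proj₁ (proj₂ relation))) (begin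
      c zero * v i                                       ≈⟨ +-identityʳ _ ⟨
      c zero * v i + 0#                                  ≈⟨ +-congˡ (quadratic-form-zero c-tail≈0 (λ k → u k i)) ⟨
      linearCombination ℝ c v∷u i                        ≈⟨ combination≈0 i ⟩
      0#                                                 ∎)

  eigenspaces-orthogonal : ∀ {n} {A : Matrix ℝ n} → (∀ i j → A i j ≈ A j i) → ∀ {x y v w} →
    InEigenspace ℝ A x v → InEigenspace ℝ A y w → ¬ (y ≈ x) → dot v w ≈ 0#
  eigenspaces-orthogonal {A = A} A-sym {x} {y} {v} {w} Av Aw y≉x =
    x*y≈0⇒y≈0 (λ p → y≉x (x-y≈0⇒x≈y p)) (trans ([y-z]x≈yx-zx (dot v w) y x) (x≈y⇒x-y≈0 (begin
      y * dot v w                ≈⟨ dot-scaleʳ y v w ⟨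
      dot v (λ i → y * w i)      ≈⟨ dot-congˡ v Aw ⟨
      dot v (mulVec ℝ A w)       ≈⟨ self-adjoint A A-sym v w ⟨
      dot (mulVec ℝ A v) w       ≈⟨ dot-congʳ w Av ⟩
      dot (λ i → x * v i) w      ≈⟨ dot-scaleˡ x v w ⟩
      x * dot v w                ∎)))

  record Eigenframe {k n} (A : Matrix ℝ n) (u : Vector (Vector Carrier n) k)
                    (l : Vector Carrier k) : Set where
    field
      orthogonalFamily : OrthogonalFamily u
      eigen            : ∀ i → InEigenspace ℝ A (l i) (u i)
    open OrthogonalFamily orthogonalFamily public

  -- Subtracting ∑ₖ lₖ uₖuₖᵀ / ⟨uₖ, uₖ⟩ moves the known eigenvalues to 0.
  module Deflation {k n} (A : Matrix ℝ n) (A-sym : ∀ i j → A i j ≈ A j i)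
                   {u : Vector (Vector Carrier n) k} {l : Vector Carrier k}
                   (frame : Eigenframe A u l) where
    open Eigenframe frame

    weight : Vector Carrier k
    weight j = l j * proj₁ (inverse-pos (norm-pos j))

    weight-norm : ∀ j → weight j * dot (u j) (u j) ≈ l j
    weight-norm j = trans
      (solve 3 (λ l t N → l :* t :* N := l :* (N :* t)) refl
        (l j) (proj₁ (inverse-pos (norm-pos j))) (dot (u j) (u j)))
      (trans (*-congˡ (proj₂ (proj₂ (inverse-pos (norm-pos j))))) (*-identityʳ _))

    deflated : Matrix ℝ n
    deflated i j = A i j - linearCombination ℝ (λ k → weight k * u k i) u j

    deflated-sym : ∀ i j → deflated i j ≈ deflated j i
    deflated-sym i j = +-cong (A-sym i j) (-‿cong (sum-cong-≋ λ k →
      solve 3 (λ t a b → t :* a :* b := t :* b :* a) refl (weight k) (u k i) (u k j)))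

    mulVec-deflated : ∀ v i → mulVec ℝ deflated v i ≈
                      mulVec ℝ A v i - sum (λ k → weight k * u k i * dot (u k) v)
    mulVec-deflated v i = trans (dot-subˡ (A i) (linearCombination ℝ (λ k → weight k * u k i) u) v)
      (+-congˡ (-‿cong (dot-combinationˡ (λ k → weight k * u k i) u v)))

    mulVec-deflated-⊥ : ∀ v → (∀ k → dot (u k) v ≈ 0#) →
                        ∀ i → mulVec ℝ deflated v i ≈ mulVec ℝ A v i
    mulVec-deflated-⊥ v u⊥v i = begin
      mulVec ℝ deflated v i                                            ≈⟨ mulVec-deflated v i ⟩
      mulVec ℝ A v i - sum (λ k → weight k * u k i * dot (u k) v)      ≈⟨ +-congˡ (-‿cong (sum-zero _ λ k → trans (*-congˡ (u⊥v k)) (zeroʳ _))) ⟩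
      mulVec ℝ A v i - 0#                                              ≈⟨ solve 1 (λ a → a :- con (+ 0) := a) refl (mulVec ℝ A v i) ⟩
      mulVec ℝ A v i                                                   ∎

    mulVec-deflated-frame : ∀ j i → mulVec ℝ deflated (u j) i ≈ 0#
    mulVec-deflated-frame j i = begin
      mulVec ℝ deflated (u j) i
        ≈⟨ mulVec-deflated (u j) i ⟩
      mulVec ℝ A (u j) i - sum (λ k → weight k * u k i * dot (u k) (u j))
        ≈⟨ +-cong (eigen j i) (-‿cong (sum-single (λ k → weight k * u k i * dot (u k) (u j)) j
             λ k k≢j → trans (*-congˡ (orthogonal k j k≢j)) (zeroʳ _))) ⟩
      l j * u j i - weight j * u j i * dot (u j) (u j)
        ≈⟨ solve 4 (λ l x t N → l :* x :- t :* x :* N := (l :- t :* N) :* x) refl (l j) (u j i) (weight j) (dot (u j) (u j)) ⟩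
      (l j - weight j * dot (u j) (u j)) * u j i
        ≈⟨ *-congʳ (x≈y⇒x-y≈0 (sym (weight-norm j))) ⟩
      0# * u j i
        ≈⟨ zeroˡ _ ⟩
      0# ∎

  extend-orthogonal : ∀ {k n} {u : Vector (Vector Carrier n) k} {w} → OrthogonalFamily u →
                      Nonzero w → (∀ j → dot (u j) w ≈ 0#) → OrthogonalFamily (w ◂ u)
  extend-orthogonal {u = u} {w} orth nz u⊥w = record
    { nonzero    = λ { zero → nz ; (suc i) → nonzero i }
    ; orthogonal = λ { zero    zero    0≢0 → contradiction ≡.refl 0≢0
                     ; zero    (suc j) _   → trans (dot-comm w (u j)) (u⊥w j)
                     ; (suc i) zero    _   → u⊥w i
                     ; (suc i) (suc j) p   → orthogonal i j (p ∘ ≡.cong suc)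
                     }
    }
    where open OrthogonalFamily orth

  module _ {k n} (A : Matrix ℝ (suc n)) (A-sym : ∀ i j → A i j ≈ A j i) (k<n : k ℕ.< suc n)
           {u : Vector (Vector Carrier (suc n)) k} {l : Vector Carrier k} (frame : Eigenframe A u l)
           (positive : ∀ v → Nonzero v → (∀ j → dot (u j) v ≈ 0#) → 0# < dot v (mulVec ℝ A v))
           where
    open Eigenframe frame
    open Deflation A A-sym frame

    private
      EigenpairOf : Matrix ℝ (suc n) → Set
      EigenpairOf B = ∃[ s ] ((∀ v → dot v (mulVec ℝ B v) ≤ s * dot v v)
                              × ∃[ w ] (Nonzero w × InEigenspace ℝ B s w))

      -- The Rayleigh bound is recorded because it orders the spectrum: eigenvectors found later are
      -- also orthogonal to `u`, so their eigenvalues are at most `s`.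
      Extension : Set
      Extension = ∃[ s ] (0# < s
        × (∀ v → (∀ j → dot (u j) v ≈ 0#) → dot v (mulVec ℝ A v) ≤ s * dot v v)
        × ∃[ w ] Eigenframe A (w ◂ u) (s ◂ l))

      -- As k is less than the dimension, some nonzero vector is orthogonal to `u`, and positivity
      -- there forces `s > 0`. The deflated matrix maps each `u j` to 0, so by self-adjointness
      -- s⟨uⱼ, w⟩ = 0 and `w` is orthogonal to `u`, where the deflated matrix acts as `A`.
      extend : EigenpairOf deflated → Extension
      extend (s , D≤s , w , nz , Dw) = s , s>0 , A≤s , w , record
        { orthogonalFamily = extend-orthogonal orthogonalFamily nz u⊥w
        ; eigen = λ { zero i → trans (sym (mulVec-deflated-⊥ w u⊥w i)) (Dw i) ; (suc j) → eigen j }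
        }
        where
        A≤s : ∀ v → (∀ j → dot (u j) v ≈ 0#) → dot v (mulVec ℝ A v) ≤ s * dot v v
        A≤s v u⊥v = ≤-respˡ-≈ (dot-congˡ v (mulVec-deflated-⊥ v u⊥v)) (D≤s v)

        s>0 : 0# < s
        s>0 = let v , v≉0 , u⊥v = nontrivial-solution k<n u in
          *-cancelˡ-0< (dot-nonneg v) (<-≤-trans (positive v v≉0 u⊥v) (A≤s v u⊥v))

        u⊥w : ∀ j → dot (u j) w ≈ 0#
        u⊥w j = x*y≈0⇒y≈0 (pos⇒≉0 s>0) (begin
          s * dot (u j) w                      ≈⟨ dot-scaleʳ s (u j) w ⟨
          dot (u j) (λ i → s * w i)            ≈⟨ dot-congˡ (u j) Dw ⟨
          dot (u j) (mulVec ℝ deflated w)      ≈⟨ self-adjoint deflated deflated-sym (u j) w ⟨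
          dot (mulVec ℝ deflated (u j)) w      ≈⟨ quadratic-form-zero (mulVec-deflated-frame j) w ⟩
          0#                                   ∎)

    extend-eigenframe : Extension
    extend-eigenframe = extend (principal-eigenpair deflated deflated-sym)

  -- Multiplicity lists from an orthogonal eigenbasis

  -- An enumeration rather than a count, because `index` selects the frame vectors that become a
  -- basis of the eigenspace.
  record Fibre {n} (l : Vector Carrier n) (x : Carrier) (m : ℕ) : Set where
    field
      index     : Fin m → Fin n
      injective : Injective _≡_ _≡_ index
      value     : ∀ j → l (index j) ≈ x
      covers    : ∀ k → l k ≈ x → ∃[ j ] index j ≡ k

  subfamily : ∀ {m k n} {u : Vector (Vector Carrier n) k} → OrthogonalFamily u →
              {f : Fin m → Fin k} → Injective _≡_ _≡_ f → OrthogonalFamily (u ∘ f)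
  subfamily orth {f} f-inj = record
    { nonzero    = λ i → nonzero (f i)
    ; orthogonal = λ i j i≢j → orthogonal (f i) (f j) (i≢j ∘ f-inj)
    }
    where open OrthogonalFamily orth

  module Eigenbasis {n} {A : Matrix ℝ n} (A-sym : ∀ i j → A i j ≈ A j i)
                    {u : Vector (Vector Carrier n) n} {l : Vector Carrier n}
                    (frame : Eigenframe A u l) where
    open Eigenframe frame

    ⊥-other-eigenspaces : ∀ {x v} → InEigenspace ℝ A x v → ∀ k → ¬ (l k ≈ x) → dot v (u k) ≈ 0#
    ⊥-other-eigenspaces Av k lₖ≉x = eigenspaces-orthogonal A-sym Av (eigen k) lₖ≉x

    -- For spanning, subtract from `v` its projection to the selected vectors. The residue is
    -- orthogonal to those by construction and to the other frame vectors because their eigenvalues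
    -- differ from `x`; hence it is zero by `maximal-orthogonal`.
    multiplicity : ∀ {x m} → Fibre l x m → HasMultiplicity ℝ A x m
    multiplicity {x} {m} fibre = (u ∘ index) , record
      { members     = λ j i → trans (eigen (index j) i) (*-congʳ (value j))
      ; independent = Sub.independent
      ; spanning    = λ v Av → coefficients v , λ i →
          x-y≈0⇒x≈y (maximal-orthogonal orthogonalFamily (residue v) (residue⊥ v Av) i)
      }
      where
      open Fibre fibre
      module Sub = OrthogonalFamily (subfamily orthogonalFamily injective)

      coefficients : Vector Carrier n → Vector Carrier m
      coefficients v j = dot v (u (index j)) * proj₁ (inverse-pos (Sub.norm-pos j))

      coefficients-norm : ∀ v j → coefficients v j * dot (u (index j)) (u (index j))
                                  ≈ dot v (u (index j))
      coefficients-norm v j = trans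
        (solve 3 (λ d t N → d :* t :* N := d :* (N :* t)) refl
          (dot v (u (index j))) (proj₁ (inverse-pos (Sub.norm-pos j)))
          (dot (u (index j)) (u (index j))))
        (trans (*-congˡ (proj₂ (proj₂ (inverse-pos (Sub.norm-pos j))))) (*-identityʳ _))

      projection residue : Vector Carrier n → Vector Carrier n
      projection v = linearCombination ℝ (coefficients v) (u ∘ index)
      residue v i = v i - projection v i

      projection-dot : ∀ v → InEigenspace ℝ A x v → ∀ k → dot (projection v) (u k) ≈ dot v (u k)
      projection-dot v Av k with l k ≟ x
      ... | yes lₖ≈x = let j , eq = covers k lₖ≈x in
        ≡.subst (λ k → dot (projection v) (u k) ≈ dot v (u k)) eq
          (trans (Sub.dot-combination (coefficients v) j) (coefficients-norm v j))
      ... | no lₖ≉x = begin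
        dot (projection v) (u k)                                  ≈⟨ dot-combinationˡ (coefficients v) (u ∘ index) (u k) ⟩
        sum (λ j → coefficients v j * dot (u (index j)) (u k))    ≈⟨ sum-zero _ (λ j → trans (*-congˡ (orthogonal (index j) k λ { ≡.refl → lₖ≉x (value j) })) (zeroʳ _)) ⟩
        0#                                                        ≈⟨ ⊥-other-eigenspaces Av k lₖ≉x ⟨
        dot v (u k)                                               ∎

      residue⊥ : ∀ v → InEigenspace ℝ A x v → ∀ k → dot (residue v) (u k) ≈ 0#
      residue⊥ v Av k = trans (dot-subˡ v (projection v) (u k))
        (x≈y⇒x-y≈0 (sym (projection-dot v Av k)))

    eigenvalue-occurs : ∀ {x} → IsEigenvalue ℝ A x → ∃[ k ] l k ≈ x
    eigenvalue-occurs {x} (v , v≉0 , Av) with any? (λ k → l k ≟ x)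
    ... | yes p = p
    ... | no ¬p = contradiction
      (maximal-orthogonal orthogonalFamily v λ k → ⊥-other-eigenspaces Av k λ q → ¬p (k , q)) v≉0

    occurs-eigenvalue : ∀ {x k} → l k ≈ x → IsEigenvalue ℝ A x
    occurs-eigenvalue {x} {k} p =
      u k , (λ uₖ≈0 → proj₂ (nonzero k) (uₖ≈0 _)) , λ i → trans (eigen k i) (*-congʳ p)

    multiplicityList : ∀ {xs ms} → Linked _<_ xs → (∀ k → l k ∈ₛ xs) →
      All (λ x → ∃[ k ] l k ≈ x) xs → Pointwise (Fibre l) xs ms → OrderedMultiplicityList ℝ A ms
    multiplicityList {xs} sorted listed occur fibres = record
      { eigenvalues    = xs
      ; increasing     = sorted
      ; complete-list  = λ x → mk⇔
          (λ ev → let k , p = eigenvalue-occurs ev in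
            SetoidMembershipProperties.∈-resp-≈ setoid p (listed k))
          (λ x∈xs → let (k , p) , q = All.lookupAny occur x∈xs in
            occurs-eigenvalue (trans p (sym q)))
      ; multiplicities = Pointwise.map multiplicity fibres
      }

  -- Uniqueness of the multiplicity list

  sorted-unique : ∀ {xs ys} → AllPairs _<_ xs → AllPairs _<_ ys →
                  (∀ z → z ∈ₛ xs → z ∈ₛ ys) → (∀ z → z ∈ₛ ys → z ∈ₛ xs) → Pointwise _≈_ xs ys
  sorted-unique [] [] _ _ = []
  sorted-unique [] (_∷_ {y} _ _) _ ys⊆xs with () ← ys⊆xs y (here refl)
  sorted-unique (_∷_ {x} _ _) [] xs⊆ys _ with () ← xs⊆ys x (here refl)
  sorted-unique (_∷_ {x} {xs} x<xs xs↗) (_∷_ {y} {ys} y<ys ys↗) xs⊆ys ys⊆xs =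
    x≈y ∷ sorted-unique xs↗ ys↗
      (λ z z∈xs → drop-head x<xs z∈xs x≈y (xs⊆ys z (there z∈xs)))
      (λ z z∈ys → drop-head y<ys z∈ys (sym x≈y) (ys⊆xs z (there z∈ys)))
    where
    below : ∀ {x z zs} → All (x <_) zs → z ∈ₛ zs → x < z
    below x<zs z∈zs = let x<w , z≈w = All.lookupAny x<zs z∈zs in <-respʳ-≈ (sym z≈w) x<w

    drop-head : ∀ {x y z zs ws} → All (x <_) zs → z ∈ₛ zs → x ≈ y → z ∈ₛ y ∷ ws → z ∈ₛ ws
    drop-head x<zs z∈zs x≈y (here z≈y) =
      contradiction (below x<zs z∈zs) (<-irrefl (trans x≈y (sym z≈y)))
    drop-head _ _ _ (there z∈ws) = z∈ws

    heads : x ∈ₛ y ∷ ys → y ∈ₛ x ∷ xs → x ≈ y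
    heads (here p)  _         = p
    heads (there _) (here p)  = sym p
    heads (there p) (there q) = contradiction (<-trans (below y<ys p) (below x<xs q)) (<-irrefl refl)

    x≈y : x ≈ y
    x≈y = heads (xs⊆ys x (here refl)) (ys⊆xs y (here refl))

  -- The exchange argument: if m′ < m, the coefficients of the `b j` with respect to `b′` form a
  -- system with fewer equations than unknowns, and a nontrivial solution is a relation among the
  -- `b j`. Passing from `P` to `Q` allows for eigenvalues that agree only up to `_≈_`.
  dimension-≤ : ∀ {n m m′} {P Q : Vector Carrier n → Set} {b b′} →
                (∀ v → P v → Q v) → IsBasis ℝ {m = m} P b → IsBasis ℝ {m = m′} Q b′ → m ℕ.≤ m′
  dimension-≤ {b = b} {b′} P⊆Q basis basis′ = ℕ.≮⇒≥ λ m′<m →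
    let c , (j , cⱼ≉0) , eqs = nontrivial-solution m′<m (λ k j → coefficients j k) in
    cⱼ≉0 (IsBasis.independent basis c (λ i → begin
      sum (λ j → c j * b j i)
        ≈⟨ sum-cong-≋ (λ j → *-congˡ (proj₂ (expansion j) i)) ⟩
      sum (λ j → c j * dot (coefficients j) (λ k → b′ k i))
        ≈⟨ dot-combinationˡ c coefficients (λ k → b′ k i) ⟨
      dot (linearCombination ℝ c coefficients) (λ k → b′ k i)
        ≈⟨ quadratic-form-zero (λ k → trans (dot-comm c (λ j → coefficients j k)) (eqs k)) _ ⟩
      0# ∎) j)
    where
    expansion = λ j → IsBasis.spanning basis′ (b j) (P⊆Q (b j) (IsBasis.members basis j))
    coefficients = λ j → proj₁ (expansion j)

  multiplicity-unique : ∀ {n} {A : Matrix ℝ n} {x y m m′} → x ≈ y →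
    HasMultiplicity ℝ A x m → HasMultiplicity ℝ A y m′ → m ≡ m′
  multiplicity-unique x≈y (_ , basis) (_ , basis′) = ℕ.≤-antisym
    (dimension-≤ (λ v Av i → trans (Av i) (*-congʳ x≈y)) basis basis′)
    (dimension-≤ (λ v Av i → trans (Av i) (*-congʳ (sym x≈y))) basis′ basis)

  multiplicityList-unique : ∀ {n} {A : Matrix ℝ n} {ms ms′} →
    OrderedMultiplicityList ℝ A ms → OrderedMultiplicityList ℝ A ms′ → ms ≡ ms′
  multiplicityList-unique {A = A} L L′ = go
    (sorted-unique (Linked⇒AllPairs <-trans L.increasing) (Linked⇒AllPairs <-trans L′.increasing)
      (λ z → Equivalence.to (L′.complete-list z) ∘ Equivalence.from (L.complete-list z))
      (λ z → Equivalence.to (L.complete-list z) ∘ Equivalence.from (L′.complete-list z)))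
    L.multiplicities L′.multiplicities
    where
    module L  = OrderedMultiplicityList L
    module L′ = OrderedMultiplicityList L′

    go : ∀ {xs ys ms ms′} → Pointwise _≈_ xs ys → Pointwise (HasMultiplicity ℝ A) xs ms →
         Pointwise (HasMultiplicity ℝ A) ys ms′ → ms ≡ ms′
    go []       []       []       = ≡.refl
    go (p ∷ ps) (q ∷ qs) (r ∷ rs) = ≡.cong₂ _∷_ (multiplicity-unique p q r) (go ps qs rs)

-- Reading the list off four ordered eigenvalues

module PawSpectra (ℝ : RealNumbers) where
  open RealNumbers ℝ hiding (zero)
  open IntegerSolver commutativeRing
  open OrderedField ℝ
  open LinearAlgebra ℝ
  open Spectral ℝ
  open Multiplicity ℝ
  open import Algebra.Properties.Ring ring
  open import Algebra.Properties.Semiring.Sum semiring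
  open import Relation.Binary.Reasoning.Setoid setoid

  singleton-fibre : ∀ {n} {l : Vector Carrier n} k → (∀ j → l j ≈ l k → k ≡ j) → Fibre l (l k) 1
  singleton-fibre k unique = record
    { index     = λ _ → k
    ; injective = λ { {0F} {0F} _ → ≡.refl }
    ; value     = λ _ → refl
    ; covers    = λ j p → 0F , unique j p
    }

  pair-fibre : ∀ {n} {l : Vector Carrier n} {i j} → i ≢ j → l j ≈ l i →
               (∀ k → l k ≈ l i → i ≡ k ⊎ j ≡ k) → Fibre l (l i) 2
  pair-fibre {i = i} {j} i≢j lⱼ≈lᵢ unique = record
    { index     = i ◂ j ◂ ε
    ; injective = λ { {0F} {0F} _ → ≡.refl
                    ; {0F} {1F} p → contradiction p i≢j
                    ; {1F} {0F} p → contradiction (≡.sym p) i≢j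
                    ; {1F} {1F} _ → ≡.refl
                    }
    ; value     = λ { 0F → refl ; 1F → lⱼ≈lᵢ }
    ; covers    = λ k p → [ (λ q → 0F , q) , (λ q → 1F , q) ]′ (unique k p)
    }

  <⇒≉ : ∀ {x y} → x < y → ¬ (x ≈ y)
  <⇒≉ p q = <-irrefl q p

  >⇒≉ : ∀ {x y} → y < x → ¬ (x ≈ y)
  >⇒≉ p q = <-irrefl (sym q) p

  module _ {A : Matrix ℝ 4} (A-sym : ∀ i j → A i j ≈ A j i)
           {u : Vector (Vector Carrier 4) 4} {l : Vector Carrier 4} (frame : Eigenframe A u l) where
    open Eigenbasis A-sym frame

    -- The order 3, 0, 1, 2 is that of `spectrum`: new eigenvectors are prepended, so `ones` ends at
    -- index 3, and larger eigenvalues are found earlier, so index 0 holds the least positive one.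
    list-1111 : l 3F < l 0F → l 0F < l 1F → l 1F < l 2F →
                OrderedMultiplicityList ℝ A (1 ∷ 1 ∷ 1 ∷ 1 ∷ [])
    list-1111 p q r = multiplicityList {xs = l 3F ∷ l 0F ∷ l 1F ∷ l 2F ∷ []}
      (p ∷ q ∷ r ∷ [-])
      (λ { 0F → there (here refl)
         ; 1F → there (there (here refl))
         ; 2F → there (there (there (here refl)))
         ; 3F → here refl })
      ((3F , refl) ∷ (0F , refl) ∷ (1F , refl) ∷ (2F , refl) ∷ [])
      ( singleton-fibre 3F (λ { 0F e → contradiction e (>⇒≉ p)
                              ; 1F e → contradiction e (>⇒≉ (<-trans p q))
                              ; 2F e → contradiction e (>⇒≉ (<-trans p (<-trans q r)))
                              ; 3F e → ≡.refl })
      ∷ singleton-fibre 0F (λ { 0F e → ≡.refl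
                              ; 1F e → contradiction e (>⇒≉ q)
                              ; 2F e → contradiction e (>⇒≉ (<-trans q r))
                              ; 3F e → contradiction e (<⇒≉ p) })
      ∷ singleton-fibre 1F (λ { 0F e → contradiction e (<⇒≉ q)
                              ; 1F e → ≡.refl
                              ; 2F e → contradiction e (>⇒≉ r)
                              ; 3F e → contradiction e (<⇒≉ (<-trans p q)) })
      ∷ singleton-fibre 2F (λ { 0F e → contradiction e (<⇒≉ (<-trans q r))
                              ; 1F e → contradiction e (<⇒≉ r)
                              ; 2F e → ≡.refl
                              ; 3F e → contradiction e (<⇒≉ (<-trans p (<-trans q r))) })
      ∷ [])

    list-112 : l 3F < l 0F → l 0F < l 1F → l 1F ≈ l 2F →
               OrderedMultiplicityList ℝ A (1 ∷ 1 ∷ 2 ∷ [])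
    list-112 p q r = multiplicityList {xs = l 3F ∷ l 0F ∷ l 1F ∷ []}
      (p ∷ q ∷ [-])
      (λ { 0F → there (here refl)
         ; 1F → there (there (here refl))
         ; 2F → there (there (here (sym r)))
         ; 3F → here refl })
      ((3F , refl) ∷ (0F , refl) ∷ (1F , refl) ∷ [])
      ( singleton-fibre 3F (λ { 0F e → contradiction e (>⇒≉ p)
                              ; 1F e → contradiction e (>⇒≉ (<-trans p q))
                              ; 2F e → contradiction (trans r e) (>⇒≉ (<-trans p q))
                              ; 3F e → ≡.refl })
      ∷ singleton-fibre 0F (λ { 0F e → ≡.refl
                              ; 1F e → contradiction e (>⇒≉ q)
                              ; 2F e → contradiction (trans r e) (>⇒≉ q)
                              ; 3F e → contradiction e (<⇒≉ p) })
      ∷ pair-fibre (λ ()) (sym r)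
                        (λ { 0F e → contradiction e (<⇒≉ q)
                           ; 1F e → inj₁ ≡.refl
                           ; 2F e → inj₂ ≡.refl
                           ; 3F e → contradiction e (<⇒≉ (<-trans p q)) })
      ∷ [])

    list-121 : l 3F < l 0F → l 0F ≈ l 1F → l 1F < l 2F →
               OrderedMultiplicityList ℝ A (1 ∷ 2 ∷ 1 ∷ [])
    list-121 p q r = multiplicityList {xs = l 3F ∷ l 0F ∷ l 2F ∷ []}
      (p ∷ q<r ∷ [-])
      (λ { 0F → there (here refl)
         ; 1F → there (here (sym q))
         ; 2F → there (there (here refl))
         ; 3F → here refl })
      ((3F , refl) ∷ (0F , refl) ∷ (2F , refl) ∷ [])
      ( singleton-fibre 3F (λ { 0F e → contradiction e (>⇒≉ p)
                              ; 1F e → contradiction (trans q e) (>⇒≉ p)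
                              ; 2F e → contradiction e (>⇒≉ (<-trans p q<r))
                              ; 3F e → ≡.refl })
      ∷ pair-fibre (λ ()) (sym q)
                        (λ { 0F e → inj₁ ≡.refl
                           ; 1F e → inj₂ ≡.refl
                           ; 2F e → contradiction e (>⇒≉ q<r)
                           ; 3F e → contradiction e (<⇒≉ p) })
      ∷ singleton-fibre 2F (λ { 0F e → contradiction e (<⇒≉ q<r)
                              ; 1F e → contradiction e (<⇒≉ r)
                              ; 2F e → ≡.refl
                              ; 3F e → contradiction e (<⇒≉ (<-trans p q<r)) })
      ∷ [])
      where
      q<r : l 0F < l 2F
      q<r = <-respˡ-≈ (sym q) r

    -- The inner product of Av - xv with `u k` is (lₖ - x)⟨v, uₖ⟩, and one of the two factors is
    -- zero for each `k`.
    eigenspace-member : ∀ {x v} → (∀ k → l k ≈ x ⊎ dot v (u k) ≈ 0#) → InEigenspace ℝ A x v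
    eigenspace-member {x} {v} h i = x-y≈0⇒x≈y
      (maximal-orthogonal orthogonalFamily (λ i → mulVec ℝ A v i - x * v i) ⊥u i)
      where
      open Eigenframe frame

      vanish : ∀ k → l k ≈ x ⊎ dot v (u k) ≈ 0# → (l k - x) * dot v (u k) ≈ 0#
      vanish k (inj₁ p) = trans (*-congʳ (x≈y⇒x-y≈0 p)) (zeroˡ _)
      vanish k (inj₂ p) = trans (*-congˡ p) (zeroʳ _)

      ⊥u : ∀ k → dot (λ i → mulVec ℝ A v i - x * v i) (u k) ≈ 0#
      ⊥u k = begin
        dot (λ i → mulVec ℝ A v i - x * v i) (u k)
          ≈⟨ dot-subˡ (mulVec ℝ A v) (λ i → x * v i) (u k) ⟩
        dot (mulVec ℝ A v) (u k) - dot (λ i → x * v i) (u k)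
          ≈⟨ +-cong (trans (self-adjoint A A-sym v (u k)) (trans (dot-congˡ v (eigen k)) (dot-scaleʳ (l k) v (u k))))
               (-‿cong (dot-scaleˡ x v (u k))) ⟩
        l k * dot v (u k) - x * dot v (u k)
          ≈⟨ [y-z]x≈yx-zx (dot v (u k)) (l k) x ⟨
        (l k - x) * dot v (u k)
          ≈⟨ vanish k (h k) ⟩
        0# ∎

  ones : ∀ {n} → Vector Carrier n
  ones _ = 1#

  -- Weighted Laplacians of the paw

  module PawLaplacian {A : Matrix ℝ 4} (L : 𝒮L ℝ Paw A) where
    open 𝒮L L renaming (symmetric to A-sym)

    -- The parameters are the off-diagonal entries at the edges {0,1}, {1,2}, {1,3}, {2,3}, that is,
    -- the negatives of the edge weights. Vertex 0 is the leaf and 1 its neighbour.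
    canonical : Carrier → Carrier → Carrier → Carrier → Matrix ℝ 4
    canonical p q r t = (- p ◂ p ◂ 0# ◂ 0# ◂ ε)
                      ◂ (p ◂ - (p + (q + r)) ◂ q ◂ r ◂ ε)
                      ◂ (0# ◂ q ◂ - (q + t) ◂ t ◂ ε)
                      ◂ (0# ◂ r ◂ t ◂ - (r + t) ◂ ε)
                      ◂ ε

    A02≈0 : A 0F 2F ≈ 0#
    A02≈0 = non-edge 0F 2F (λ ()) (λ ())

    A03≈0 : A 0F 3F ≈ 0#
    A03≈0 = non-edge 0F 3F (λ ()) (λ ())

    entries : ∀ i j → A i j ≈ canonical (A 0F 1F) (A 1F 2F) (A 1F 3F) (A 2F 3F) i j
    entries 0F 0F = trans (diagonal 0F) (-‿cong (trans
      (+-congˡ (+-congˡ (+-cong A02≈0 (+-congʳ A03≈0))))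
      (solve 1 (λ p → con (+ 0) :+ (p :+ (con (+ 0) :+ (con (+ 0) :+ con (+ 0)))) := p) refl (A 0F 1F))))
    entries 0F 1F = refl
    entries 0F 2F = A02≈0
    entries 0F 3F = A03≈0
    entries 1F 0F = A-sym 1F 0F
    entries 1F 1F = trans (diagonal 1F) (-‿cong (trans
      (+-congʳ (A-sym 1F 0F))
      (solve 3 (λ p q r → p :+ (con (+ 0) :+ (q :+ (r :+ con (+ 0)))) := p :+ (q :+ r))
        refl (A 0F 1F) (A 1F 2F) (A 1F 3F))))
    entries 1F 2F = refl
    entries 1F 3F = refl
    entries 2F 0F = trans (A-sym 2F 0F) A02≈0
    entries 2F 1F = A-sym 2F 1F
    entries 2F 2F = trans (diagonal 2F) (-‿cong (trans
      (+-cong (trans (A-sym 2F 0F) A02≈0) (+-congʳ (A-sym 2F 1F)))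
      (solve 2 (λ q t → con (+ 0) :+ (q :+ (con (+ 0) :+ (t :+ con (+ 0)))) := q :+ t)
        refl (A 1F 2F) (A 2F 3F))))
    entries 2F 3F = refl
    entries 3F 0F = trans (A-sym 3F 0F) A03≈0
    entries 3F 1F = A-sym 3F 1F
    entries 3F 2F = A-sym 3F 2F
    entries 3F 3F = trans (diagonal 3F) (-‿cong (trans
      (+-cong (trans (A-sym 3F 0F) A03≈0) (+-cong (A-sym 3F 1F) (+-congʳ (A-sym 3F 2F))))
      (solve 2 (λ r t → con (+ 0) :+ (r :+ (t :+ (con (+ 0) :+ con (+ 0)))) := r :+ t)
        refl (A 1F 3F) (A 2F 3F))))

    mulVec-ones : InEigenspace ℝ A 0# ones
    mulVec-ones i = trans (dot-congʳ ones (entries i)) (trans (row i) (sym (zeroˡ 1#)))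
      where
      p = A 0F 1F
      q = A 1F 2F
      r = A 1F 3F
      t = A 2F 3F
      row : ∀ i → dot (canonical p q r t i) ones ≈ 0#
      row 0F = solve 1 (λ p → (:- p) :* con (+ 1) :+ (p :* con (+ 1) :+ (con (+ 0) :* con (+ 1) :+ (con (+ 0) :* con (+ 1) :+ con (+ 0)))) := con (+ 0)) refl p
      row 1F = solve 3 (λ p q r → p :* con (+ 1) :+ ((:- (p :+ (q :+ r))) :* con (+ 1) :+ (q :* con (+ 1) :+ (r :* con (+ 1) :+ con (+ 0)))) := con (+ 0)) refl p q r
      row 2F = solve 2 (λ q t → con (+ 0) :* con (+ 1) :+ (q :* con (+ 1) :+ ((:- (q :+ t)) :* con (+ 1) :+ (t :* con (+ 1) :+ con (+ 0)))) := con (+ 0)) refl q t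
      row 3F = solve 2 (λ r t → con (+ 0) :* con (+ 1) :+ (r :* con (+ 1) :+ (t :* con (+ 1) :+ ((:- (r :+ t)) :* con (+ 1) :+ con (+ 0)))) := con (+ 0)) refl r t

    -- The Dirichlet form of the weighted graph: one spring per edge, with positive stiffness
    -- `- A i j`.
    energy : Vector Carrier 4 → Carrier
    energy v = - A 0F 1F * ((v 0F - v 1F) * (v 0F - v 1F)) + (
               - A 1F 2F * ((v 1F - v 2F) * (v 1F - v 2F)) + (
               - A 1F 3F * ((v 1F - v 3F) * (v 1F - v 3F)) +
               - A 2F 3F * ((v 2F - v 3F) * (v 2F - v 3F))))

    form≈energy : ∀ v → dot v (mulVec ℝ A v) ≈ energy v
    form≈energy v = trans (dot-congˡ v λ i → dot-congʳ v (entries i))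
      (solve 8 (λ p q r t w x y z →
        w :* ((:- p) :* w :+ (p :* x :+ (con (+ 0) :* y :+ (con (+ 0) :* z :+ con (+ 0)))))
        :+ (x :* (p :* w :+ ((:- (p :+ (q :+ r))) :* x :+ (q :* y :+ (r :* z :+ con (+ 0)))))
        :+ (y :* (con (+ 0) :* w :+ (q :* x :+ ((:- (q :+ t)) :* y :+ (t :* z :+ con (+ 0)))))
        :+ (z :* (con (+ 0) :* w :+ (r :* x :+ (t :* y :+ ((:- (r :+ t)) :* z :+ con (+ 0)))))
        :+ con (+ 0))))
        := (:- p) :* ((w :- x) :* (w :- x)) :+ (
           (:- q) :* ((x :- y) :* (x :- y)) :+ (
           (:- r) :* ((x :- z) :* (x :- z)) :+
           (:- t) :* ((y :- z) :* (y :- z)))))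
        refl (A 0F 1F) (A 1F 2F) (A 1F 3F) (A 2F 3F) (v 0F) (v 1F) (v 2F) (v 3F))

    weight-pos : ∀ {i j} → SimpleGraph.Adj Paw i j → 0# < - A i j
    weight-pos adj = x<0⇒0<-x (edge _ _ adj)

    spring-nonneg : ∀ {w} x → 0# < w → 0# ≤ w * (x * x)
    spring-nonneg x w>0 = *-nonneg (inj₁ w>0) (square-nonneg x)

    -- The edges at vertex 1 form a spanning star. Either one of their springs is stretched and the
    -- energy is positive, or `v` is constant; then orthogonality to `ones` reads 4v₁ = 0, contrary
    -- to `nz`.
    positive : ∀ v → Nonzero v → dot ones v ≈ 0# → 0# < dot v (mulVec ℝ A v)
    positive v nz v⊥1 = <-respʳ-≈ (sym (form≈energy v)) energy-pos
      where
      a>0 = weight-pos {0F} {1F} ≡.refl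
      b>0 = weight-pos {1F} {2F} (λ ())
      c>0 = weight-pos {1F} {3F} (λ ())
      d>0 = weight-pos {2F} {3F} (λ ())

      spring-pos : ∀ {w x y} → 0# < w → ¬ (x ≈ y) → 0# < w * ((x - y) * (x - y))
      spring-pos w>0 x≉y = *-pos w>0 (square-pos λ p → x≉y (x-y≈0⇒x≈y p))

      constant⇒zero : v 0F ≈ v 1F → v 1F ≈ v 2F → v 1F ≈ v 3F → ∀ i → v i ≈ 0#
      constant⇒zero p q r = λ { 0F → trans p v₁≈0 ; 1F → v₁≈0 ; 2F → trans (sym q) v₁≈0 ; 3F → trans (sym r) v₁≈0 }
        where
        v₁≈0 : v 1F ≈ 0#
        v₁≈0 = x*y≈0⇒y≈0 (pos⇒≉0 (fromℤ-pos 3)) (trans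
          (solve 1 (λ x → con (+ 4) :* x := con (+ 1) :* x :+ (con (+ 1) :* x :+ (con (+ 1) :* x :+ (con (+ 1) :* x :+ con (+ 0))))) refl (v 1F))
          (trans (+-cong (*-congˡ (sym p)) (+-congˡ (+-cong (*-congˡ q) (+-congʳ (*-congˡ r))))) v⊥1))

      energy-pos : 0# < energy v
      energy-pos with v 0F ≟ v 1F | v 1F ≟ v 2F | v 1F ≟ v 3F
      ... | no v₀≉v₁ | _ | _ = +-pos-nonneg (spring-pos a>0 v₀≉v₁)
        (+-nonneg (spring-nonneg _ b>0) (+-nonneg (spring-nonneg _ c>0) (spring-nonneg _ d>0)))
      ... | yes _ | no v₁≉v₂ | _ = +-nonneg-pos (spring-nonneg _ a>0)
        (+-pos-nonneg (spring-pos b>0 v₁≉v₂) (+-nonneg (spring-nonneg _ c>0) (spring-nonneg _ d>0)))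
      ... | yes _ | yes _ | no v₁≉v₃ = +-nonneg-pos (spring-nonneg _ a>0)
        (+-nonneg-pos (spring-nonneg _ b>0) (+-pos-nonneg (spring-pos c>0 v₁≉v₃) (spring-nonneg _ d>0)))
      ... | yes p | yes q | yes r = contradiction (constant⇒zero p q r (proj₁ nz)) (proj₂ nz)

    eigenframe-ones : Eigenframe {k = 1} A (λ _ → ones) (λ _ → 0#)
    eigenframe-ones = record
      { orthogonalFamily = record
        { nonzero    = λ _ → 0F , λ p → 0≉1 (sym p)
        ; orthogonal = λ { 0F 0F 0≢0 → contradiction ≡.refl 0≢0 }
        }
      ; eigen = λ _ → mulVec-ones
      }

    eigenvalue-≤ : ∀ {x s w} → Nonzero w → InEigenspace ℝ A x w →
                   dot w (mulVec ℝ A w) ≤ s * dot w w → x ≤ s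
    eigenvalue-≤ {x} {s} {w} nz Aw p = *-cancelʳ-≤ (dot-pos w nz)
      (≤-respˡ-≈ (trans (dot-congˡ w Aw) (dot-scaleʳ x w w)) p)

    -- The equation `u 3F ≡ ones` is kept for `not-scalar`, which needs to know that the other three
    -- frame vectors are orthogonal to `ones` alone, so that a test vector in 1^⊥ can be used.
    Spectrum : Set
    Spectrum = ∃[ u ] ∃[ l ] (Eigenframe {k = 4} A u l × u 3F ≡ ones
                 × l 3F < l 0F × l 0F ≤ l 1F × l 1F ≤ l 2F)

    spectrum : Spectrum
    spectrum =
      -- Each extension shifts `ones` by one place, so orthogonality to it is read at index 0, then
      -- 1, then 2.
      let s₁ , _ , A≤s₁ , w₁ , frame₁ = extend-eigenframe A A-sym (ℕ.m≤m+n 2 2) eigenframe-ones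
            (λ v nz ⊥ → positive v nz (⊥ 0F))
          s₂ , _ , A≤s₂ , w₂ , frame₂ = extend-eigenframe A A-sym (ℕ.m≤m+n 3 1) frame₁
            (λ v nz ⊥ → positive v nz (⊥ 1F))
          s₃ , s₃>0 , _ , w₃ , frame₃ = extend-eigenframe A A-sym (ℕ.m≤m+n 4 0) frame₂
            (λ v nz ⊥ → positive v nz (⊥ 2F))
          module F₂ = Eigenframe frame₂
          module F₃ = Eigenframe frame₃
      in _ , _ , frame₃ , ≡.refl , s₃>0
         -- The bound for `s₂` holds on the orthogonal complement of `frame₁`, whose vectors sit in
         -- `frame₃` from index 2 on; `w₃` is orthogonal to them, so it yields s₃ ≤ s₂.
         , eigenvalue-≤ (F₃.nonzero 0F) (F₃.eigen 0F)
             (A≤s₂ w₃ λ j → F₃.orthogonal (suc (suc j)) 0F λ ())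
         , eigenvalue-≤ (F₂.nonzero 0F) (F₂.eigen 0F)
             (A≤s₁ w₂ λ j → F₂.orthogonal (suc (suc j)) 0F λ ())

    e₀-e₂ : Vector Carrier 4
    e₀-e₂ = 1# ◂ 0# ◂ - 1# ◂ 0# ◂ ε

    not-scalar : ∀ {u : Vector (Vector Carrier 4) 4} {l : Vector Carrier 4} → Eigenframe A u l → u 3F ≡ ones → l 0F ≈ l 1F → l 1F ≈ l 2F → ⊥
    not-scalar {u} {l} frame u₃≡1 p q = pos⇒≉0 (weight-pos {2F} {3F} (λ ())) (begin
      - A 2F 3F
        ≈⟨ solve 3 (λ r t x → :- t := con (+ 0) :* con (+ 1) :+ (r :* con (+ 0) :+ (t :* (:- con (+ 1)) :+ (x :* con (+ 0) :+ con (+ 0)))))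
             refl (A 1F 3F) (A 2F 3F) (A 3F 3F) ⟩
      0# * 1# + (A 1F 3F * 0# + (A 2F 3F * - 1# + (A 3F 3F * 0# + 0#)))
        ≈⟨ +-cong (*-congʳ (entries 3F 0F)) (+-cong (*-congʳ (entries 3F 1F)) (+-congʳ (*-congʳ (entries 3F 2F)))) ⟨
      mulVec ℝ A e₀-e₂ 3F
        ≈⟨ eigenspace-member A-sym frame {v = e₀-e₂} spectral 3F ⟩
      l 2F * 0#
        ≈⟨ zeroʳ (l 2F) ⟩
      0# ∎)
      where
      spectral : ∀ k → l k ≈ l 2F ⊎ dot e₀-e₂ (u k) ≈ 0#
      spectral 0F = inj₁ (trans p q)
      spectral 1F = inj₁ q
      spectral 2F = inj₁ refl
      spectral 3F = inj₂ (≡.subst (λ w → dot e₀-e₂ w ≈ 0#) (≡.sym u₃≡1)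
        (solve 0 (con (+ 1) :* con (+ 1) :+ (con (+ 0) :* con (+ 1) :+ ((:- con (+ 1)) :* con (+ 1) :+ (con (+ 0) :* con (+ 1) :+ con (+ 0)))) := con (+ 0)) refl))

    classification : ∃[ ms ] (OrderedMultiplicityList ℝ A ms
      × ms ∈ (1 ∷ 1 ∷ 1 ∷ 1 ∷ []) ∷ (1 ∷ 1 ∷ 2 ∷ []) ∷ (1 ∷ 2 ∷ 1 ∷ []) ∷ [])
    classification = classify spectrum
      where
      classify : Spectrum → _
      classify (u , l , frame , _ , p , inj₁ q , inj₁ r) =
        _ , list-1111 A-sym frame p q r , here ≡.refl
      classify (u , l , frame , _ , p , inj₁ q , inj₂ r) =
        _ , list-112 A-sym frame p q r , there (here ≡.refl)
      classify (u , l , frame , _ , p , inj₂ q , inj₁ r) =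
        _ , list-121 A-sym frame p q r , there (there (here ≡.refl))
      classify (u , l , frame , u₃≡1 , p , inj₂ q , inj₂ r) =
        contradiction (not-scalar frame u₃≡1 q r) λ ()

  -- Laplacians with integer spectrum

  sumℤ : ∀ {n} → Vector ℤ n → ℤ
  sumℤ = foldr ℤ._+_ (+ 0)

  dotℤ : ∀ {n} → Vector ℤ n → Vector ℤ n → ℤ
  dotℤ x y = sumℤ λ i → x i ℤ.* y i

  fromℤ-sum : ∀ {n} (f : Vector ℤ n) → fromℤ (sumℤ f) ≈ sum (fromℤ ∘ f)
  fromℤ-sum {zero}  f = refl
  fromℤ-sum {suc n} f = trans (fromℤ-+ (f zero) (sumℤ (tail f))) (+-congˡ (fromℤ-sum (tail f)))

  fromℤ-dot : ∀ {n} (x y : Vector ℤ n) →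
              fromℤ (sumℤ λ i → x i ℤ.* y i) ≈ dot (fromℤ ∘ x) (fromℤ ∘ y)
  fromℤ-dot x y = trans (fromℤ-sum λ i → x i ℤ.* y i) (sum-cong-≋ λ i → fromℤ-* (x i) (y i))

  fromℤ-nonzero : ∀ i → i ≢ + 0 → ¬ (fromℤ i ≈ 0#)
  fromℤ-nonzero (+ zero)  p = contradiction ≡.refl p
  fromℤ-nonzero (+ suc n) _ = pos⇒≉0 (fromℤ-pos n)
  fromℤ-nonzero -[1+ n ]  _ = <⇒≉ (fromℤ-< -[1+ n ] (+ 0) ≡.refl)

  module _ {n k} (M : Vector (Vector ℤ n) n) (u : Vector (Vector ℤ n) k) (l : Vector ℤ k) where
    infix 4 _⊥?_
    _⊥?_ : ∀ i j → Dec (i ≡ j ⊎ dotℤ (u i) (u j) ≡ + 0)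
    i ⊥? j = (i Fin.≟ j) ⊎-dec (dotℤ (u i) (u j) ℤ.≟ + 0)

    -- On closed integer data the three `True` arguments evaluate to the unit type and are filled in
    -- silently, so orthogonality and the eigenvalue equations are checked by computation in ℤ and
    -- carried over by `fromℤ`.
    integral-eigenframe :
      {True (all? λ i → any? λ j → ¬? (u i j ℤ.≟ + 0))} →
      {True (all? λ i → all? λ j → i ⊥? j)} →
      {True (all? λ i → all? λ j → dotℤ (M j) (u i) ℤ.≟ l i ℤ.* u i j)} →
      Eigenframe (λ i j → fromℤ (M i j)) (λ i j → fromℤ (u i j)) (fromℤ ∘ l)
    integral-eigenframe {nonzero} {orthogonal} {eigen} = record
      { orthogonalFamily = record
        { nonzero    = λ i → let j , p = toWitness nonzero i in j , fromℤ-nonzero (u i j) p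
        ; orthogonal = λ i j i≢j → trans (sym (fromℤ-dot (u i) (u j)))
            (reflexive (≡.cong fromℤ ([ (λ i≡j → contradiction i≡j i≢j) , (λ p → p) ]′ (toWitness orthogonal i j))))
        }
      ; eigen = λ i j → trans (sym (fromℤ-dot (M j) (u i)))
          (trans (reflexive (≡.cong fromℤ (toWitness eigen i j))) (fromℤ-* (l i) (u i j)))
      }

  -- Edge weights 1 + a on the pendant edge, 1 + b on its two neighbours, 1 + d on
  -- the edge opposite to it.
  paw : ℕ → ℕ → ℕ → Vector (Vector ℤ 4) 4
  paw a b d = (+ suc a ◂ -[1+ a ] ◂ + 0 ◂ + 0 ◂ ε)
            ◂ (-[1+ a ] ◂ + (2 ℕ.+ (a ℕ.+ suc (b ℕ.+ b))) ◂ -[1+ b ] ◂ -[1+ b ] ◂ ε)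
            ◂ (+ 0 ◂ -[1+ b ] ◂ + (2 ℕ.+ (b ℕ.+ d)) ◂ -[1+ d ] ◂ ε)
            ◂ (+ 0 ◂ -[1+ b ] ◂ -[1+ d ] ◂ + (2 ℕ.+ (b ℕ.+ d)) ◂ ε)
            ◂ ε

  pawMatrix : ℕ → ℕ → ℕ → Matrix ℝ 4
  pawMatrix a b d i j = fromℤ (paw a b d i j)

  paw-symmetric : ∀ a b d i j → pawMatrix a b d i j ≈ pawMatrix a b d j i
  paw-symmetric a b d 0F 0F = refl
  paw-symmetric a b d 0F 1F = refl
  paw-symmetric a b d 0F 2F = refl
  paw-symmetric a b d 0F 3F = refl
  paw-symmetric a b d 1F 0F = refl
  paw-symmetric a b d 1F 1F = refl
  paw-symmetric a b d 1F 2F = refl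
  paw-symmetric a b d 1F 3F = refl
  paw-symmetric a b d 2F 0F = refl
  paw-symmetric a b d 2F 1F = refl
  paw-symmetric a b d 2F 2F = refl
  paw-symmetric a b d 2F 3F = refl
  paw-symmetric a b d 3F 0F = refl
  paw-symmetric a b d 3F 1F = refl
  paw-symmetric a b d 3F 2F = refl
  paw-symmetric a b d 3F 3F = refl

  negative : ∀ n → fromℤ -[1+ n ] < 0#
  negative n = fromℤ-< -[1+ n ] (+ 0) ≡.refl

  paw∈𝒮L : ∀ a b d → 𝒮L ℝ Paw (pawMatrix a b d)
  paw∈𝒮L a b d = record
    { symmetric = paw-symmetric a b d
    ; edge      = paw-edge
    ; non-edge  = paw-non-edge
    ; diagonal  = λ i → trans (reflexive (≡.cong fromℤ (diagonalℤ i)))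
        (trans (fromℤ-neg (sumℤ (updateAt (paw a b d i) i (λ _ → + 0))))
          (-‿cong (trans (fromℤ-sum (updateAt (paw a b d i) i (λ _ → + 0)))
            (sum-cong-≋ λ j → reflexive (map-updateAt {f = fromℤ} {g = λ _ → + 0} {h = λ _ → 0#} (λ _ → ≡.refl) (paw a b d i) i j)))))
    }
    where
    paw-edge : ∀ i j → SimpleGraph.Adj Paw i j → pawMatrix a b d i j < 0#
    paw-edge 0F 1F _   = negative a
    paw-edge 0F 2F ()
    paw-edge 0F 3F ()
    paw-edge 1F 0F _   = negative a
    paw-edge 1F 1F 0≢0 = contradiction ≡.refl 0≢0
    paw-edge 1F 2F _   = negative b
    paw-edge 1F 3F _   = negative b
    paw-edge 2F 0F ()
    paw-edge 2F 1F _   = negative b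
    paw-edge 2F 2F 1≢1 = contradiction ≡.refl 1≢1
    paw-edge 2F 3F _   = negative d
    paw-edge 3F 0F ()
    paw-edge 3F 1F _   = negative b
    paw-edge 3F 2F _   = negative d
    paw-edge 3F 3F 2≢2 = contradiction ≡.refl 2≢2

    paw-non-edge : ∀ i j → i ≢ j → ¬ SimpleGraph.Adj Paw i j → pawMatrix a b d i j ≈ 0#
    paw-non-edge 0F 0F 0≢0 _  = contradiction ≡.refl 0≢0
    paw-non-edge 0F 1F _ ¬adj = contradiction ≡.refl ¬adj
    paw-non-edge 0F 2F _ _    = refl
    paw-non-edge 0F 3F _ _    = refl
    paw-non-edge 1F 0F _ ¬adj = contradiction ≡.refl ¬adj
    paw-non-edge 2F 0F _ _    = refl
    paw-non-edge 3F 0F _ _    = refl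
    paw-non-edge (suc i) (suc j) i≢j ¬adj = contradiction (i≢j ∘ ≡.cong suc) ¬adj

    -- The diagonal of `paw` is written in the shape to which addition of `-[1+_]` terms reduces,
    -- with its extra `suc`s; hence `≡.refl` even for variable weights.
    diagonalℤ : ∀ i → paw a b d i i ≡ ℤ.- sumℤ (updateAt (paw a b d i) i (λ _ → + 0))
    diagonalℤ 0F = ≡.refl
    diagonalℤ 1F = ≡.refl
    diagonalℤ 2F = ≡.refl
    diagonalℤ 3F = ≡.refl

  attained-1111 : ∃[ A ] (𝒮L ℝ Paw A × OrderedMultiplicityList ℝ A (1 ∷ 1 ∷ 1 ∷ 1 ∷ []))
  -- All weights 1. The eigenvector for a root λ of the quadratic is a multiple of (λ/b - 3, 1 -
  -- λ/b, 1, 1), here and in the two other examples.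
  attained-1111 = _ , paw∈𝒮L 0 0 0 ,
    list-1111 (paw-symmetric 0 0 0)
      (integral-eigenframe (paw 0 0 0)
        ( (-[1+ 1 ] ◂ + 0 ◂ + 1 ◂ + 1 ◂ ε)
        ◂ (+ 0 ◂ + 0 ◂ + 1 ◂ -[1+ 0 ] ◂ ε)
        ◂ (+ 1 ◂ -[1+ 2 ] ◂ + 1 ◂ + 1 ◂ ε)
        ◂ (+ 1 ◂ + 1 ◂ + 1 ◂ + 1 ◂ ε)
        ◂ ε)
        (+ 1 ◂ + 3 ◂ + 4 ◂ + 0 ◂ ε))
      (fromℤ-< (+ 0) (+ 1) ≡.refl) (fromℤ-< (+ 1) (+ 3) ≡.refl) (fromℤ-< (+ 3) (+ 4) ≡.refl)

  attained-112 : ∃[ A ] (𝒮L ℝ Paw A × OrderedMultiplicityList ℝ A (1 ∷ 1 ∷ 2 ∷ []))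
  -- For a = b the roots are b and 4b; the weights 2, 2, 3 make b + 2d equal to the larger root 8.
  attained-112 = _ , paw∈𝒮L 1 1 2 ,
    list-112 (paw-symmetric 1 1 2)
      (integral-eigenframe (paw 1 1 2)
        ( (-[1+ 1 ] ◂ + 0 ◂ + 1 ◂ + 1 ◂ ε)
        ◂ (+ 0 ◂ + 0 ◂ + 1 ◂ -[1+ 0 ] ◂ ε)
        ◂ (+ 1 ◂ -[1+ 2 ] ◂ + 1 ◂ + 1 ◂ ε)
        ◂ (+ 1 ◂ + 1 ◂ + 1 ◂ + 1 ◂ ε)
        ◂ ε)
        (+ 2 ◂ + 8 ◂ + 8 ◂ + 0 ◂ ε))
      (fromℤ-< (+ 0) (+ 2) ≡.refl) (fromℤ-< (+ 2) (+ 8) ≡.refl) refl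

  attained-121 : ∃[ A ] (𝒮L ℝ Paw A × OrderedMultiplicityList ℝ A (1 ∷ 2 ∷ 1 ∷ []))
  -- Now b + 2d has to equal the smaller root, which exceeds b only if a > b. For a = 9, b = 4 the
  -- discriminant 4a² - 4ab + 9b² is 18², the roots are 6 and 24, and d = 1 gives b + 2d = 6.
  attained-121 = _ , paw∈𝒮L 8 3 0 ,
    list-121 (paw-symmetric 8 3 0)
      (integral-eigenframe (paw 8 3 0)
        ( (+ 3 ◂ + 1 ◂ -[1+ 1 ] ◂ -[1+ 1 ] ◂ ε)
        ◂ (+ 0 ◂ + 0 ◂ + 1 ◂ -[1+ 0 ] ◂ ε)
        ◂ (+ 3 ◂ -[1+ 4 ] ◂ + 1 ◂ + 1 ◂ ε)
        ◂ (+ 1 ◂ + 1 ◂ + 1 ◂ + 1 ◂ ε)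
        ◂ ε)
        (+ 6 ◂ + 6 ◂ + 24 ◂ + 0 ◂ ε))
      (fromℤ-< (+ 0) (+ 6) ≡.refl) refl (fromℤ-< (+ 6) (+ 24) ≡.refl)

theorem3p6 : (ℝ : RealNumbers) (ms : List ℕ) →
    (∃[ A ] (𝒮L ℝ Paw A × OrderedMultiplicityList ℝ A ms))
    ⇔
    (ms ∈ (1 ∷ 1 ∷ 1 ∷ 1 ∷ []) ∷ (1 ∷ 1 ∷ 2 ∷ []) ∷ (1 ∷ 2 ∷ 1 ∷ []) ∷ [])
theorem3p6 ℝ ms = mk⇔
  (λ { (A , L , list) → let ms′ , list′ , ms′∈ = PawLaplacian.classification L in
       ≡.subst (_∈ _) (multiplicityList-unique list′ list) ms′∈ })
  λ { (here ≡.refl)                 → attained-1111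
    ; (there (here ≡.refl))         → attained-112
    ; (there (there (here ≡.refl))) → attained-121 }
  where
  open PawSpectra ℝ
  open Multiplicity ℝ using (multiplicityList-unique)
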